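{- For every real number $\zeta>\frac{41}{2}$ there exists a positive integer $c=c(\zeta)$ such that there is an $O(n^2)$-time algorithm which, given a bipartite graph $G$ on $n=|V(G)|$ vertices with $\Delta:=\Delta(G)\ge c$ and $n\ge \zeta\Delta$, constructs an equitable $\left(\left\lceil \Delta/2\right\rceil+1\right)$-coloring of $G$.
   Context: Graphs have finite vertex sets, no loops, and no parallel edges. $\Delta(G)$ denotes the maximum degree of $G$. A proper $k$-coloring of $G$ (an assignment of colors from a set of $k$ colors to the vertices in which adjacent vertices get distinct colors) is equitable if the sizes of any two of its $k$ color classes differ by at most one. Arithmetic operations on integers are counted as taking constant time. -}

module Defs where

open import Data.Bool.Base using (Bool; true; false; if_then_else_; not; _∧_)
open import Data.Empty using (⊥)
open import Data.Fin.Base using (Fin; toℕ; fromℕ<; remQuot)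
import Data.Fin.Properties as Fin
open import Data.Fin.Subset using (∣_∣)
open import Data.Integer.Base as ℤ using (ℤ; +_; -[1+_])
import Data.Integer.Properties as ℤ
open import Data.List.Base using (map; allFin)
open import Data.List.Extrema.Nat using (max)
open import Data.Nat.Base using (ℕ; suc; _+_; _*_; _≤_)
open import Data.Nat.Properties using (_≟_; _<?_)
open import Data.Product.Base using (Σ-syntax; ∃-syntax; _×_; uncurry)
open import Data.Rational.Base as ℚ using (ℚ)
open import Data.Sum.Base using (_⊎_)
open import Data.Vec.Base using (tabulate)
open import Function.Bundles using (_⇔_)
open import Relation.Binary.PropositionalEquality using (_≡_; _≢_)
open import Relation.Nullary.Decidable using (does; yes; no)

------------------------------------------------------------------------
-- Real numbers

-- Two-sided Dedekind cuts: Lower q means q < x, and Upper q means x < q.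
record ℝ : Set₁ where
  field
    Lower           : ℚ → Set
    Upper           : ℚ → Set
    lower-inhabited : ∃[ q ] Lower q
    upper-inhabited : ∃[ q ] Upper q
    lower-rounded   : ∀ q → Lower q ⇔ (∃[ r ] (q ℚ.< r × Lower r))
    upper-rounded   : ∀ q → Upper q ⇔ (∃[ r ] (r ℚ.< q × Upper r))
    disjoint        : ∀ q → Lower q → Upper q → ⊥
    located         : ∀ q r → q ℚ.< r → Lower q ⊎ Upper r

infix 4 _<ᵣ_ _·_≤ᵣ_

_<ᵣ_ : ℚ → ℝ → Set
q <ᵣ x = ℝ.Lower x q

-- x d ≤ m for natural numbers d and m: since d ≥ 0, the real number x d is the
-- supremum of the rationals q d with q < x.
_·_≤ᵣ_ : ℝ → ℕ → ℕ → Set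
x · d ≤ᵣ m = ∀ q → q <ᵣ x → q ℚ.* (+ d ℚ./ 1) ℚ.≤ + m ℚ./ 1

------------------------------------------------------------------------
-- Graphs and colorings

record Graph (n : ℕ) : Set where
  field
    adj      : Fin n → Fin n → Bool
    adj-sym  : ∀ u v → adj u v ≡ adj v u
    loopless : ∀ v → adj v v ≡ false

open Graph public

degree : ∀ {n} → Graph n → Fin n → ℕ
degree G v = ∣ tabulate (adj G v) ∣

Δ : ∀ {n} → Graph n → ℕ
Δ {n} G = max 0 (map (degree G) (allFin n))

Proper : ∀ {n k} → Graph n → (Fin n → Fin k) → Set
Proper G f = ∀ u v → adj G u v ≡ true → f u ≢ f v

Bipartite : ∀ {n} → Graph n → Set
Bipartite {n} G = Σ[ side ∈ (Fin n → Fin 2) ] Proper G side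

classSize : ∀ {n k} → (Fin n → Fin k) → Fin k → ℕ
classSize f a = ∣ tabulate (λ v → does (f v Fin.≟ a)) ∣

EquitableColoring : ∀ {n} k → Graph n → (Fin n → Fin k) → Set
EquitableColoring k G f =
  Proper G f × (∀ a b → classSize f a ≤ suc (classSize f b))

------------------------------------------------------------------------
-- Algorithms: structured programs for a unit-cost random access machine.
-- Registers and memory cells hold arbitrary integers, and every arithmetic
-- operation, comparison, access, assignment and branching decision costs one
-- step.

data Expr : Set where
  lit                     : ℤ → Expr
  reg[_]                  : ℕ → Expr
  mem[_]                  : Expr → Expr
  _⊕_ _⊖_ _⊗_ _⊘_         : Expr → Expr → Expr

data Test : Set where
  _≤?ᵉ_ _=?ᵉ_             : Expr → Expr → Test
  notᵉ                    : Test → Test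
  _andᵉ_                  : Test → Test → Test

infixr 4 _⨟_
infix  5 reg[_]≔_ mem[_]≔_

data Program : Set where
  skip                    : Program
  reg[_]≔_                : ℕ → Expr → Program
  mem[_]≔_                : Expr → Expr → Program
  _⨟_                     : Program → Program → Program
  ifᵖ_then_else_          : Test → Program → Program → Program
  while_loop_             : Test → Program → Program

record State : Set where
  constructor ⟨_,_⟩
  field
    registers : ℕ → ℤ
    memory    : ℤ → ℤ

open State public

-- Integer division (with nonnegative remainder), made total by x div 0 = 0.
_div_ : ℤ → ℤ → ℤ
x div (+ 0)         = + 0
x div y@(+ (suc _)) = x ℤ./ y
x div y@(-[1+ _ ])  = x ℤ./ y

⟦_⟧ : Expr → State → ℤ
⟦ lit z    ⟧ s = z
⟦ reg[ i ] ⟧ s = registers s i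
⟦ mem[ e ] ⟧ s = memory s (⟦ e ⟧ s)
⟦ d ⊕ e    ⟧ s = ⟦ d ⟧ s ℤ.+ ⟦ e ⟧ s
⟦ d ⊖ e    ⟧ s = ⟦ d ⟧ s ℤ.- ⟦ e ⟧ s
⟦ d ⊗ e    ⟧ s = ⟦ d ⟧ s ℤ.* ⟦ e ⟧ s
⟦ d ⊘ e    ⟧ s = ⟦ d ⟧ s div ⟦ e ⟧ s

⟦_⟧ᵗ : Test → State → Bool
⟦ d ≤?ᵉ e  ⟧ᵗ s = does (⟦ d ⟧ s ℤ.≤? ⟦ e ⟧ s)
⟦ d =?ᵉ e  ⟧ᵗ s = does (⟦ d ⟧ s ℤ.≟ ⟦ e ⟧ s)
⟦ notᵉ b   ⟧ᵗ s = not (⟦ b ⟧ᵗ s)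
⟦ a andᵉ b ⟧ᵗ s = ⟦ a ⟧ᵗ s ∧ ⟦ b ⟧ᵗ s

cost : Expr → ℕ
cost (lit _)  = 1
cost reg[ _ ] = 1
cost mem[ e ] = suc (cost e)
cost (d ⊕ e)  = suc (cost d + cost e)
cost (d ⊖ e)  = suc (cost d + cost e)
cost (d ⊗ e)  = suc (cost d + cost e)
cost (d ⊘ e)  = suc (cost d + cost e)

costᵗ : Test → ℕ
costᵗ (d ≤?ᵉ e)  = suc (cost d + cost e)
costᵗ (d =?ᵉ e)  = suc (cost d + cost e)
costᵗ (notᵉ b)   = suc (costᵗ b)
costᵗ (a andᵉ b) = suc (costᵗ a + costᵗ b)

setReg : ℕ → ℤ → State → State
setReg i z s =
  ⟨ (λ j → if does (j ≟ i) then z else registers s j) , memory s ⟩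

setMem : ℤ → ℤ → State → State
setMem a z s =
  ⟨ registers s , (λ b → if does (b ℤ.≟ a) then z else memory s b) ⟩

-- Run p s t s′ : started in s, the program p halts in s′ after exactly t steps.
data Run : Program → State → ℕ → State → Set where
  run-skip   : ∀ {s} → Run skip s 1 s
  run-reg    : ∀ {i e s} →
               Run (reg[ i ]≔ e) s (suc (cost e)) (setReg i (⟦ e ⟧ s) s)
  run-mem    : ∀ {d e s} →
               Run (mem[ d ]≔ e) s (suc (cost d + cost e))
                   (setMem (⟦ d ⟧ s) (⟦ e ⟧ s) s)
  run-seq    : ∀ {p q s s′ s″ t t′} → Run p s t s′ → Run q s′ t′ s″ →
               Run (p ⨟ q) s (t + t′) s″
  run-then   : ∀ {b p q s s′ t} → ⟦ b ⟧ᵗ s ≡ true → Run p s t s′ →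
               Run (ifᵖ b then p else q) s (suc (costᵗ b + t)) s′
  run-else   : ∀ {b p q s s′ t} → ⟦ b ⟧ᵗ s ≡ false → Run q s t s′ →
               Run (ifᵖ b then p else q) s (suc (costᵗ b + t)) s′
  run-exit   : ∀ {b p s} → ⟦ b ⟧ᵗ s ≡ false →
               Run (while b loop p) s (suc (costᵗ b)) s
  run-repeat : ∀ {b p s s′ s″ t t′} → ⟦ b ⟧ᵗ s ≡ true →
               Run p s t s′ → Run (while b loop p) s′ t′ s″ →
               Run (while b loop p) s (suc (costᵗ b + (t + t′))) s″

-- Input convention: register 0 holds n, cell n u + v holds the (u , v) entry
-- of the adjacency matrix, and all other registers and cells hold 0.
inputRegisters : ℕ → ℕ → ℤ
inputRegisters n 0       = + n
inputRegisters n (suc _) = + 0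

inputMemory : ∀ {n} → Graph n → ℤ → ℤ
inputMemory G -[1+ _ ] = + 0
inputMemory {n} G (+ a) with a <? n * n
... | yes a<n² = if uncurry (adj G) (remQuot n (fromℕ< a<n²)) then + 1 else + 0
... | no  _    = + 0

input : ∀ {n} → Graph n → State
input {n} G = ⟨ inputRegisters n , inputMemory G ⟩

-- Output convention: the color of vertex v is in cell n² + v, i.e. the output
-- immediately follows the adjacency matrix.
Outputs : ∀ {n k} → State → (Fin n → Fin k) → Set
Outputs {n} s f = ∀ v → memory s (+ (n * n + toℕ v)) ≡ + toℕ (f v)

{-# OPTIONS --safe #-}
-- Let k = ⌈Δ/2⌉ + 1 and let s = ⌊n/k⌋, so that the classes have s or s + 1 vertices.
-- First-fit the smaller side of a bipartition, filling whole classes as long as its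
-- size allows and giving at most s/8 vertices to each further class; then first-fit
-- the larger side into the remaining room.  At most 16 classes are mixed.  A vertex
-- of the larger side could only be stuck because of a mixed class with room, but the
-- at most s/8 vertices of the smaller side in that class have at most sΔ/8 neighbours,
-- whereas about k/2 classes further on are full of vertices that the class refused.
-- Since k ≥ Δ/2 + 1, this is impossible for large Δ.
--
-- The algorithm is written in a small language of bounded loops, whose commands denote
-- total functions on named arrays; two nested loops compile to quadratic running time.
module Submission where

open import Defs
open import Data.Fin.Base using (Fin)
open import Data.Integer.Base using (+_)
open import Data.Nat.Base using (ℕ; _+_; _*_; _^_; _≤_; _<_; ⌈_/2⌉)
open import Data.Product.Base using (Σ-syntax; ∃-syntax; _×_)
open import Data.Rational.Base using (_/_)

open import Data.Bool.Base using (Bool; true; false; if_then_else_; not; _∧_; _∨_; _xor_; T)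
import Data.Bool.Properties as Bool
open import Data.Empty using (⊥; ⊥-elim)
open import Data.Fin using (zero; suc; toℕ; #_; fromℕ<; combine; remQuot)
import Data.Fin.Properties as Fin
open import Data.Fin.Subset using (Subset; ∣_∣)
open import Data.Integer.Base as ℤ using (ℤ)
import Data.Integer.DivMod as ℤ
import Data.Integer.Properties as ℤ
import Data.List.Base as List
open import Data.List.Extrema.Nat using (xs≤max; max≤v⁺)
import Data.List.Membership.Propositional.Properties as List
import Data.List.Relation.Unary.All as All
import Data.List.Relation.Unary.All.Properties as All
open import Data.Nat.Base as ℕ using
  ( zero; suc; _∸_; _≤ᵇ_; _≡ᵇ_; _≤‴_; ≤‴-refl; ≤‴-step; ⌊_/2⌋
  ; z≤n; s≤s; s≤s⁻¹; >-nonZero )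
open import Data.Nat.DivMod using (_%_; [m+kn]%n≡m%n; m<n⇒m%n≡m; m%n<n; m/n*n≤m; m≡m%n+[m/n]*n)
open import Data.Nat.Properties
open import Data.Nat.Tactic.RingSolver using (solve-∀)
open import Data.Product.Base using (_,_; proj₁; proj₂; uncurry)
import Data.Rational.Base as ℚ
import Data.Rational.Properties as ℚ
import Data.Rational.Unnormalised.Base as ℚᵘ
import Data.Rational.Unnormalised.Properties as ℚᵘ
open import Data.Sum.Base using (_⊎_; inj₁; inj₂; [_,_]′)
open import Data.Unit.Base using (tt)
open import Data.Vec.Base using (_∷_; tabulate)
open import Function.Base using (_∘_; id)
open import Function.Bundles using (mk⇔)
open import Relation.Binary.PropositionalEquality
open import Relation.Nullary.Decidable
  using (Dec; does; yes; no; True; toWitness; _×-dec_; _⊎-dec_; ¬?; does-⇔)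
open import Relation.Nullary.Negation using (¬_; contradiction)
open import Relation.Unary using (Decidable)

-- A class without room can never leave a vertex of the larger side stuck, so the smaller side is
-- packed into as many full classes as possible. The fewer than s + 1 vertices left over must be
-- spread thinly, but over a bounded number of classes. The fraction 1/8 serves both ends: since s
-- is at least 8, 16 times the rounded share exceeds s, which is the origin of the number 16; and as
-- the smaller side has at most n/2 vertices, at least k/2 - 16 classes stay free of it, which is
-- more than Δ/8 once Δ is at least 200. Refusal can be detected afterwards: during the second phase
-- the colors of the smaller side are frozen and classes only grow. So a class with room now also
-- had room when any later-colored vertex passed it by, and that vertex must have a neighbour among
-- its few vertices of the smaller side.

bit : Bool → ℕ
bit false = 0
bit true  = 1

-- A language of bounded loops

-- The number of names matches the stride 16 of the memory layout, where the residue modulo 16 of an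
-- address tells the array.
Name : Set
Name = Fin 16

Heap : Set
Heap = Name → ℕ → ℕ

Env : Set
Env = ℕ → ℕ

infixl 7 _*′_ _/′_
infixl 6 _+′_
infix  5 _≤′_ _≡′_
infixr 4 _and_
infixr 3 _or_
infix  8 _at_
infix  3 _at_≔_
infixr 1 _⨾_
infix  2 when_then_else_

-- In a command at level r, at most r loops are nested, and the counters of the
-- enclosing loops are those with index at least r.
data Exp (r : ℕ) : Set where
  num            : ℕ → Exp r
  size           : Exp r
  ctr            : ∀ e {_ : True (r ≤? e)} → Exp r
  _at_           : Name → Exp r → Exp r
  _+′_ _*′_ _/′_ : Exp r → Exp r → Exp r

data Cond (r : ℕ) : Set where
  edge      : ∀ e f {_ : True (r ≤? e)} {_ : True (r ≤? f)} → Cond r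
  _≤′_ _≡′_ : Exp r → Exp r → Cond r
  neg       : Cond r → Cond r
  _and_     : Cond r → Cond r → Cond r
  _or_      : Cond r → Cond r → Cond r

data Cmd : ℕ → Set where
  skip            : ∀ {r} → Cmd r
  _at_≔_          : ∀ {r} → Name → Exp r → Exp r → Cmd r
  _⨾_             : ∀ {r} → Cmd r → Cmd r → Cmd r
  when_then_else_ : ∀ {r} → Cond r → Cmd r → Cmd r → Cmd r
  for             : ∀ {r} → Cmd r → Cmd (suc r)

-- Division by zero gives zero, in agreement with `div` on the machine.
quot : ℕ → ℕ → ℕ
quot x zero      = 0
quot x y@(suc _) = x ℕ./ y

update : Name → ℕ → ℕ → Heap → Heap
update x i z h y j =
  if does (y Fin.≟ x) then (if does (j ≟ i) then z else h y j) else h y j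

_[_≔_] : Env → ℕ → ℕ → Env
(ρ [ r ≔ i ]) e = if does (e ≟ r) then i else ρ e

iter : (ℕ → Heap → Heap) → ℕ → Heap → Heap
iter f zero    h = h
iter f (suc i) h = f i (iter f i h)

module Semantics (n : ℕ) (E : ℕ → ℕ → Bool) where

  eval : ∀ {r} → Exp r → Env → Heap → ℕ
  eval (num z)  ρ h = z
  eval size     ρ h = n
  eval (ctr e)  ρ h = ρ e
  eval (x at a) ρ h = h x (eval a ρ h)
  eval (a +′ b) ρ h = eval a ρ h + eval b ρ h
  eval (a *′ b) ρ h = eval a ρ h * eval b ρ h
  eval (a /′ b) ρ h = quot (eval a ρ h) (eval b ρ h)

  Holds : ∀ {r} → Cond r → Env → Heap → Set
  Holds (edge e f) ρ h = E (ρ e) (ρ f) ≡ true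
  Holds (a ≤′ b)   ρ h = eval a ρ h ≤ eval b ρ h
  Holds (a ≡′ b)   ρ h = eval a ρ h ≡ eval b ρ h
  Holds (neg c)    ρ h = ¬ Holds c ρ h
  Holds (c and d)  ρ h = Holds c ρ h × Holds d ρ h
  Holds (c or d)   ρ h = Holds c ρ h ⊎ Holds d ρ h

  holds? : ∀ {r} (c : Cond r) ρ h → Dec (Holds c ρ h)
  holds? (edge e f) ρ h = E (ρ e) (ρ f) Bool.≟ true
  holds? (a ≤′ b)   ρ h = eval a ρ h ≤? eval b ρ h
  holds? (a ≡′ b)   ρ h = eval a ρ h ≟ eval b ρ h
  holds? (neg c)    ρ h = ¬? (holds? c ρ h)
  holds? (c and d)  ρ h = holds? c ρ h ×-dec holds? d ρ h
  holds? (c or d)   ρ h = holds? c ρ h ⊎-dec holds? d ρ h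

  exec : ∀ {r} → Cmd r → Env → Heap → Heap
  exec skip                   ρ h = h
  exec (x at a ≔ b)           ρ h = update x (eval a ρ h) (eval b ρ h) h
  exec (c ⨾ d)                ρ h = exec d ρ (exec c ρ h)
  exec (when b then c else d) ρ h = if does (holds? b ρ h) then exec c ρ h else exec d ρ h
  exec (for {r} c)            ρ h = iter (λ i → exec c (ρ [ r ≔ i ])) n h

  iter-invariant : ∀ (P : ℕ → Heap → Set) {f} m {h} → P 0 h →
                   (∀ i h′ → i < m → P i h′ → P (suc i) (f i h′)) → P m (iter f m h)
  iter-invariant P zero    p₀ step = p₀
  iter-invariant P (suc m) p₀ step =
    step m _ ≤-refl (iter-invariant P m p₀ (λ i h′ i<m → step i h′ (m<n⇒m<1+n i<m)))

  writes : ∀ {r} → Cmd r → Name → Bool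
  writes skip                   x = false
  writes (y at _ ≔ _)           x = does (x Fin.≟ y)
  writes (c ⨾ d)                x = writes c x ∨ writes d x
  writes (when _ then c else d) x = writes c x ∨ writes d x
  writes (for c)                x = writes c x

  private
    ∨-falseˡ : ∀ a {b} → a ∨ b ≡ false → a ≡ false
    ∨-falseˡ false _ = refl

    ∨-falseʳ : ∀ a {b} → a ∨ b ≡ false → b ≡ false
    ∨-falseʳ false eq = eq

  -- As `writes` is syntactic and computes, the hypothesis is discharged by `refl` for any concrete
  -- command and array.
  frame : ∀ {r} (c : Cmd r) {ρ h x} → writes c x ≡ false → ∀ j → exec c ρ h x j ≡ h x j
  frame skip eq j = refl
  frame (y at a ≔ b) eq j rewrite eq = refl
  frame (c ⨾ d) {x = x} eq j =
    trans (frame d (∨-falseʳ (writes c x) eq) j) (frame c (∨-falseˡ (writes c x) eq) j)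
  frame (when b then c else d) {ρ} {h} {x} eq j with holds? b ρ h
  ... | yes _ = frame c (∨-falseˡ (writes c x) eq) j
  ... | no _  = frame d (∨-falseʳ (writes c x) eq) j
  frame (for c) {h = h} {x} eq j =
    iter-invariant (λ _ h′ → h′ x j ≡ h x j) n refl
      (λ i h′ _ p → trans (frame c eq j) p)

  Agree : ∀ {r} → Cmd r → Heap → Heap → Set
  Agree c h h′ = ∀ x → writes c x ≡ false → ∀ j → h′ x j ≡ h x j

  -- The Hoare rule for loops with the frame property built into the invariant: `P` has to speak
  -- only of the arrays that the body writes, and the others may be compared with the initial heap
  -- at every iteration.
  for-rule : ∀ {r} (c : Cmd r) ρ h (P : ℕ → Heap → Set) → P 0 h →
             (∀ i h′ → i < n → Agree c h h′ → P i h′ →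
              P (suc i) (exec c (ρ [ r ≔ i ]) h′)) →
             P n (exec (for c) ρ h)
  for-rule {r} c ρ h P p₀ step = proj₂ (iter-invariant
    (λ i h′ → Agree c h h′ × P i h′) n
    ((λ _ _ _ → refl) , p₀)
    (λ i h′ i<n (same , p) → (λ x eq j → trans (frame c eq j) (same x eq j)) ,
                          step i h′ i<n same p))

-- Compilation to the random access machine

-- Register 0 holds n, and register e + 1 is the counter e.  The array 0 occupies the
-- output cells; the others are interleaved at negative addresses.
address : Name → Expr → Expr
address zero    a = (reg[ 0 ] ⊗ reg[ 0 ]) ⊕ a
address (suc x) a = lit (ℤ.- + 1) ⊗ ((lit (+ 16) ⊗ a) ⊕ lit (+ suc (toℕ x)))

compileᵉ : ∀ {r} → Exp r → Expr
compileᵉ (num z)  = lit (+ z)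
compileᵉ size     = reg[ 0 ]
compileᵉ (ctr e)  = reg[ suc e ]
compileᵉ (x at a) = mem[ address x (compileᵉ a) ]
compileᵉ (a +′ b) = compileᵉ a ⊕ compileᵉ b
compileᵉ (a *′ b) = compileᵉ a ⊗ compileᵉ b
compileᵉ (a /′ b) = compileᵉ a ⊘ compileᵉ b

compileᵗ : ∀ {r} → Cond r → Test
compileᵗ (edge e f) = mem[ (reg[ 0 ] ⊗ reg[ suc e ]) ⊕ reg[ suc f ] ] =?ᵉ lit (+ 1)
compileᵗ (a ≤′ b)   = compileᵉ a ≤?ᵉ compileᵉ b
compileᵗ (a ≡′ b)   = compileᵉ a =?ᵉ compileᵉ b
compileᵗ (neg c)    = notᵉ (compileᵗ c)
compileᵗ (c and d)  = compileᵗ c andᵉ compileᵗ d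
compileᵗ (c or d)   = notᵉ (notᵉ (compileᵗ c) andᵉ notᵉ (compileᵗ d))

compile : ∀ {r} → Cmd r → Program
compile skip                   = skip
compile (x at a ≔ b)           = mem[ address x (compileᵉ a) ]≔ compileᵉ b
compile (c ⨾ d)                = compile c ⨟ compile d
compile (when b then c else d) = ifᵖ compileᵗ b then compile c else compile d
compile (for {r} c)            =
  reg[ suc r ]≔ lit (+ 0) ⨟
  (while notᵉ (reg[ 0 ] ≤?ᵉ reg[ suc r ]) loop
    (compile c ⨟ reg[ suc r ]≔ reg[ suc r ] ⊕ lit (+ 1)))

-- The coefficient K of the time bound K (n + 1)^r. A loop costs 7 steps once and 9 per iteration
-- beyond its body; 16 dominates both.
stepFactor : ∀ {r} → Cmd r → ℕ
stepFactor skip                   = 1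
stepFactor (x at a ≔ b)           = suc (cost (address x (compileᵉ a)) + cost (compileᵉ b))
stepFactor (c ⨾ d)                = stepFactor c + stepFactor d
stepFactor (when b then c else d) = suc (costᵗ (compileᵗ b) + (stepFactor c + stepFactor d))
stepFactor (for c)                = 16 + stepFactor c

location : ℕ → Name → ℕ → ℤ
location n zero    w = + (n * n + w)
location n (suc x) w = ℤ.- + (16 * w + suc (toℕ x))

-- The motive `P` is explicit, so that an invariant can be proved of the outcome of a conditional by
-- giving one proof for each branch.
choose : ∀ {Q : Set} (q : Dec Q) {x y : Heap} (P : Heap → Set) →
         (Q → P x) → (¬ Q → P y) → P (if does q then x else y)
choose (yes q) P t f = t q
choose (no ¬q) P t f = f ¬q

-- does (v ≟ w) computes to v ≡ᵇ w, on which proofs therefore have to split.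
data Comparison (v w : ℕ) : Bool → Set where
  equal   : v ≡ w → Comparison v w true
  unequal : v ≢ w → Comparison v w false

compare-≡ᵇ : ∀ v w → Comparison v w (v ≡ᵇ w)
compare-≡ᵇ v w with v ≡ᵇ w in eq
... | true  = equal (≡ᵇ⇒≡ v w (subst T (sym eq) _))
... | false = unequal (λ v≡w → subst T eq (≡⇒≡ᵇ v w v≡w))

update-same : ∀ x i z h → update x i z h x i ≡ z
update-same x i z h with x Fin.≟ x | i ≡ᵇ i | compare-≡ᵇ i i
... | yes _  | true  | _        = refl
... | yes _  | false | unequal i≢i = contradiction refl i≢i
... | no x≢x | _     | _        = contradiction refl x≢x

update-other : ∀ x {i j} z h → j ≢ i → update x i z h x j ≡ h x j
update-other x {i} {j} z h j≢i with x Fin.≟ x | j ≡ᵇ i | compare-≡ᵇ j i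
... | yes _ | true  | equal j≡i = contradiction j≡i j≢i
... | yes _ | false | _        = refl
... | no _  | _     | _        = refl

private
  residue : ∀ w x → x < 16 → (16 * w + x) % 16 ≡ x
  residue w x x<16 = begin
    (16 * w + x) % 16 ≡⟨ cong (λ z → z % 16) (trans (+-comm (16 * w) x)
      (cong (λ z → x + z) (*-comm 16 w))) ⟩
    (x + w * 16) % 16 ≡⟨ [m+kn]%n≡m%n x w 16 ⟩
    x % 16            ≡⟨ m<n⇒m%n≡m x<16 ⟩
    x                 ∎
    where open ≡-Reasoning

-- The sign separates array 0 from the other arrays, and among those the residue modulo 16
-- determines the array; it is never 0 because names after the first are shifted to 1, ..., 15.
location-injective : ∀ n x y {v w} → location n x v ≡ location n y w → x ≡ y × v ≡ w
location-injective n zero zero {v} {w} eq = refl , +-cancelˡ-≡ (n * n) v w (ℤ.+-injective eq)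
location-injective n zero (suc y) {w = w} eq with 16 * w + suc (toℕ y) in e
... | zero  = contradiction (trans (sym (+-suc (16 * w) (toℕ y))) e) (λ ())
... | suc _ = contradiction eq (λ ())
location-injective n (suc x) zero {v} eq with 16 * v + suc (toℕ x) in e
... | zero  = contradiction (trans (sym (+-suc (16 * v) (toℕ x))) e) (λ ())
... | suc _ = contradiction eq (λ ())
location-injective n (suc x) (suc y) {v} {w} eq = x≡y , v≡w
  where
  eqℕ : 16 * v + suc (toℕ x) ≡ 16 * w + suc (toℕ y)
  eqℕ = ℤ.+-injective (ℤ.neg-injective eq)
  x≡y : Fin.suc x ≡ suc y
  x≡y = Fin.toℕ-injective (trans (sym (residue v _ (Fin.toℕ<n (suc x))))
          (trans (cong (λ z → z % 16) eqℕ) (residue w _ (Fin.toℕ<n (suc y)))))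
  v≡w : v ≡ w
  v≡w = *-cancelˡ-≡ v w 16 (+-cancelʳ-≡ (suc (toℕ x)) _ _
          (trans eqℕ (cong (λ z → 16 * w + toℕ z) (sym x≡y))))

-- Correctness and running time of compiled commands

module Simulation (n : ℕ) (E : ℕ → ℕ → Bool) where
  open Semantics n E

  -- Counters below r are left unconstrained because inner loops overwrite their registers. The
  -- bound `ρ e < n` keeps the lookups of `edge` inside the matrix.
  record Represents (r : ℕ) (s : State) (ρ : Env) (h : Heap) : Set where
    field
      size-reg : registers s 0 ≡ + n
      counters : ∀ e → r ≤ e → registers s (suc e) ≡ + ρ e × ρ e < n
      cells    : ∀ x w → memory s (location n x w) ≡ + h x w
      matrix   : ∀ u v → u < n → v < n → memory s (+ (n * u + v)) ≡ + bit (E u v)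
  open Represents

  private
    -1*+ : ∀ m → (ℤ.- + 1) ℤ.* + m ≡ ℤ.- + m
    -1*+ m = ℤ.-1*i≡-i (+ m)

    div-quot : ∀ a b → (+ a) div (+ b) ≡ + quot a b
    div-quot a zero    = refl
    div-quot a (suc b) = ℤ.div-pos-is-/ℕ (+ a) (suc b)

  address-correct : ∀ x {a w s} → registers s 0 ≡ + n → ⟦ a ⟧ s ≡ + w →
                    ⟦ address x a ⟧ s ≡ location n x w
  address-correct zero {w = w} eqn eqa
    rewrite eqn | eqa = cong (ℤ._+ + w) (sym (ℤ.pos-* n n))
  address-correct (suc x) {w = w} eqn eqa
    rewrite eqa | sym (ℤ.pos-* 16 w) = -1*+ (16 * w + suc (toℕ x))

  eval-correct : ∀ {r s ρ h} (a : Exp r) → Represents r s ρ h →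
                 ⟦ compileᵉ a ⟧ s ≡ + eval a ρ h
  eval-correct (num z)  R = refl
  eval-correct size     R = size-reg R
  eval-correct (ctr e {r≤e}) R = proj₁ (counters R e (toWitness r≤e))
  eval-correct {s = s} (x at a) R =
    trans (cong (memory s) (address-correct x (size-reg R) (eval-correct a R))) (cells R x _)
  eval-correct (a +′ b) R = cong₂ ℤ._+_ (eval-correct a R) (eval-correct b R)
  eval-correct {ρ = ρ} {h} (a *′ b) R =
    trans (cong₂ ℤ._*_ (eval-correct a R) (eval-correct b R))
      (sym (ℤ.pos-* (eval a ρ h) (eval b ρ h)))
  eval-correct {ρ = ρ} {h} (a /′ b) R =
    trans (cong₂ _div_ (eval-correct a R) (eval-correct b R)) (div-quot (eval a ρ h) (eval b ρ h))

  test-correct : ∀ {r s ρ h} (b : Cond r) → Represents r s ρ h →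
                 ⟦ compileᵗ b ⟧ᵗ s ≡ does (holds? b ρ h)
  test-correct {ρ = ρ} (edge e f {r≤e} {r≤f}) R
    with counters R e (toWitness r≤e) | counters R f (toWitness r≤f)
  ... | eqe , e<n | eqf , f<n
    rewrite size-reg R | eqe | eqf | sym (ℤ.pos-* n (ρ e)) | matrix R (ρ e) (ρ f) e<n f<n
    with E (ρ e) (ρ f)
  ... | false = refl
  ... | true  = refl
  test-correct (a ≤′ b)  R rewrite eval-correct a R | eval-correct b R = refl
  test-correct (a ≡′ b)  R rewrite eval-correct a R | eval-correct b R = refl
  test-correct (neg c)   R = cong not (test-correct c R)
  test-correct (c and d) R = cong₂ _∧_ (test-correct c R) (test-correct d R)
  test-correct (c or d)  R = trans (cong₂ (λ a b → not (not a ∧ not b)) (test-correct c R)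
    (test-correct d R))
                                   (de-morgan (does (holds? c _ _)) _)
    where
    de-morgan : ∀ a b → not (not a ∧ not b) ≡ a ∨ b
    de-morgan true  b = refl
    de-morgan false b = Bool.not-involutive b

  private
    pow-pos : ∀ r → 1 ≤ suc n ^ r
    pow-pos r = m^n>0 (suc n) r

    const≤ : ∀ K r → K ≤ K * suc n ^ r
    const≤ K r = subst (_≤ K * suc n ^ r) (*-identityʳ K) (*-monoʳ-≤ K (pow-pos r))

    setMem-represents : ∀ {r s ρ h} x w z → Represents r s ρ h →
                        Represents r (setMem (location n x w) (+ z) s) ρ (update x w z h)
    setMem-represents {s = s} {h = h} x w z R = record
      { size-reg = size-reg R
      ; counters = counters R
      ; cells    = cells′
      ; matrix   = matrix′
      }
      where
      cells′ : ∀ y v → memory (setMem (location n x w) (+ z) s) (location n y v) ≡ + update x w z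
        h y v
      cells′ y v with location n y v ℤ.≟ location n x w | y Fin.≟ x | v ≡ᵇ w | compare-≡ᵇ v w
      ... | yes _  | yes _    | true  | equal _    = refl
      ... | yes eq | yes _    | false | unequal v≢w  = contradiction
        (proj₂ (location-injective n y x eq)) v≢w
      ... | yes eq | no y≢x   | _     | _         = contradiction
        (proj₁ (location-injective n y x eq)) y≢x
      ... | no ne  | yes refl | true  | equal refl = contradiction refl ne
      ... | no _   | yes _    | false | unequal _    = cells R y v
      ... | no _   | no _     | _     | _         = cells R y v
      -- Writes never damage the input: the matrix ends before n², where array 0 begins, and all
      -- other arrays lie at negative addresses.
      outside : ∀ y {u v} → u < n → v < n → + (n * u + v) ≢ location n y w
      outside zero {u} {v} u<n v<n eq = <⇒≱ in-matrix
        (≤-trans (m≤m+n (n * n) w) (≤-reflexive (sym (ℤ.+-injective eq))))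
        where
        in-matrix : n * u + v < n * n
        in-matrix = begin-strict
          n * u + v <⟨ +-monoʳ-< (n * u) v<n ⟩
          n * u + n ≡⟨ trans (+-comm (n * u) n) (sym (*-suc n u)) ⟩
          n * suc u ≤⟨ *-monoʳ-≤ n u<n ⟩
          n * n     ∎
          where open ≤-Reasoning
      outside (suc y) {u} {v} _ _ eq with 16 * w + suc (toℕ y) in e
      ... | zero  = contradiction (trans (sym (+-suc (16 * w) (toℕ y))) e) (λ ())
      ... | suc _ = contradiction eq (λ ())
      matrix′ : ∀ u v → u < n → v < n →
                memory (setMem (location n x w) (+ z) s) (+ (n * u + v)) ≡ + bit (E u v)
      matrix′ u v u<n v<n with + (n * u + v) ℤ.≟ location n x w
      ... | yes eq = contradiction eq (outside x u<n v<n)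
      ... | no _   = matrix R u v u<n v<n

    weaken : ∀ {r s ρ h} → Represents r s ρ h → Represents (suc r) s ρ h
    weaken R = record
      { size-reg = size-reg R
      ; counters = λ e r<e → counters R e (<⇒≤ r<e)
      ; cells    = cells R
      ; matrix   = matrix R
      }

    forget-counter : ∀ {r s ρ h i} → Represents (suc r) s (ρ [ r ≔ i ]) h → Represents (suc r) s ρ h
    forget-counter {r} {s} {ρ} {i = i} R = record
      { size-reg = size-reg R
      ; counters = counters′
      ; cells    = cells R
      ; matrix   = matrix R
      }
      where
      counters′ : ∀ e → suc r ≤ e → registers s (suc e) ≡ + ρ e × ρ e < n
      counters′ e r<e with e ≡ᵇ r | compare-≡ᵇ e r | counters R e r<e
      ... | true  | equal refl | _ = contradiction r<e (<-irrefl refl)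
      ... | false | unequal _    | c = c

    enter : ∀ {r s ρ h i} → Represents (suc r) s ρ h → registers s (suc r) ≡ + i → i < n →
            Represents r s (ρ [ r ≔ i ]) h
    enter {r} {s} {ρ} {i = i} R eqi i<n = record
      { size-reg = size-reg R
      ; counters = counters′
      ; cells    = cells R
      ; matrix   = matrix R
      }
      where
      counters′ : ∀ e → r ≤ e → registers s (suc e) ≡ + (ρ [ r ≔ i ]) e × (ρ [ r ≔ i ]) e < n
      counters′ e r≤e with e ≡ᵇ r | compare-≡ᵇ e r
      ... | true  | equal refl = eqi , i<n
      ... | false | unequal e≢r  = counters R e (≤∧≢⇒< r≤e (e≢r ∘ sym))

    setReg-represents : ∀ {r s ρ h} z → Represents (suc r) s ρ h →
                        Represents (suc r) (setReg (suc r) z s) ρ h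
    setReg-represents {r} {s} {ρ} z R = record
      { size-reg = size-reg R
      ; counters = counters′
      ; cells    = cells R
      ; matrix   = matrix R
      }
      where
      counters′ : ∀ e → suc r ≤ e → registers (setReg (suc r) z s) (suc e) ≡ + ρ e × ρ e < n
      counters′ e r<e with e ≡ᵇ r | compare-≡ᵇ e r
      ... | true  | equal refl = contradiction r<e (<-irrefl refl)
      ... | false | unequal _    = counters R e r<e

    setReg-same : ∀ i z s → registers (setReg i z s) i ≡ z
    setReg-same i z s with i ≡ᵇ i | compare-≡ᵇ i i
    ... | true  | _        = refl
    ... | false | unequal i≢i = contradiction refl i≢i

  -- The level is the exponent of the time bound, so commands of level 2 take quadratic time. The
  -- base n + 1 instead of n leaves room for the overhead of a loop even if n = 0.
  Simulates : ∀ {r} → Cmd r → Set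
  Simulates {r} c = ∀ {s ρ h} → Represents r s ρ h →
    Σ[ t ∈ ℕ ] Σ[ s′ ∈ State ]
      (Run (compile c) s t s′ × t ≤ stepFactor c * suc n ^ r × Represents r s′ ρ (exec c ρ h))

  private
    module Loop {r} (c : Cmd r) (body : Simulates c) (ρ : Env) where
      guard : Test
      guard = notᵉ (reg[ 0 ] ≤?ᵉ reg[ suc r ])

      body′ : Program
      body′ = compile c ⨟ reg[ suc r ]≔ reg[ suc r ] ⊕ lit (+ 1)

      bound : ℕ
      bound = stepFactor c * suc n ^ r

      guard-true : ∀ {s i} → registers s 0 ≡ + n → registers s (suc r) ≡ + i → i < n →
        ⟦ guard ⟧ᵗ s ≡ true
      guard-true {i = i} eqn eqi i<n rewrite eqn | eqi with n ≤ᵇ i in eq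
      ... | true  = contradiction (≤ᵇ⇒≤ n i (subst T (sym eq) _)) (<⇒≱ i<n)
      ... | false = refl

      guard-false : ∀ {s} → registers s 0 ≡ + n → registers s (suc r) ≡ + n → ⟦ guard ⟧ᵗ s ≡ false
      guard-false eqn eqi rewrite eqn | eqi with n ≤ᵇ n in eq
      ... | true  = refl
      ... | false = ⊥-elim (subst T eq (≤⇒≤ᵇ (≤-refl {n})))

      -- Induction on the number m of iterations still to come, while `iter` records the i
      -- iterations already done. Each iteration spends 5 steps on the guard and 4 on the increment;
      -- the final failing guard costs 5.
      remaining : ∀ m i {s h} → i + m ≡ n → Represents (suc r) s ρ
        (iter (λ j → exec c (ρ [ r ≔ j ])) i h) →
                  registers s (suc r) ≡ + i →
                  Σ[ t ∈ ℕ ] Σ[ s′ ∈ State ]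
                    (Run (while guard loop body′) s t s′ × t ≤ m * (9 + bound) + 5 ×
                     Represents (suc r) s′ ρ (iter (λ j → exec c (ρ [ r ≔ j ])) n h))
      remaining zero i {s} {h} i+0≡n R eqi with trans (sym (+-identityʳ i)) i+0≡n
      ... | refl = _ , s , run-exit (guard-false {s} (size-reg R) eqi) , ≤-refl , R
      remaining (suc m) i {s} {h} i+1+m≡n R eqi
        with body (enter R eqi i<n)
        where i<n = subst (suc i ≤_) (trans (sym (+-suc i m)) i+1+m≡n) (m≤m+n (suc i) m)
      ... | t , s₁ , run₁ , t≤ , R₁
        with counters R₁ r ≤-refl
      ... | eqi₁ , _
        with remaining m (suc i) (trans (sym (+-suc i m)) i+1+m≡n)
               (setReg-represents (⟦ reg[ suc r ] ⊕ lit (+ 1) ⟧ s₁) (forget-counter (weaken R₁)))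
               (trans (setReg-same (suc r) _ s₁) (eqi′ eqi₁))
        where
        env-same : (ρ [ r ≔ i ]) r ≡ i
        env-same with r ≡ᵇ r | compare-≡ᵇ r r
        ... | true  | _        = refl
        ... | false | unequal r≢r = contradiction refl r≢r
        eqi′ : registers s₁ (suc r) ≡ + (ρ [ r ≔ i ]) r → registers s₁ (suc r) ℤ.+ + 1 ≡ + suc i
        eqi′ eq rewrite eq | env-same = cong +_ (+-comm i 1)
      ... | t′ , s₂ , run₂ , t′≤ , R₂ =
        _ , s₂ , run-repeat (guard-true {s} (size-reg R) eqi i<n) (run-seq run₁ run-reg) run₂ ,
          time≤ , R₂
        where
        i<n : i < n
        i<n = subst (suc i ≤_) (trans (sym (+-suc i m)) i+1+m≡n) (m≤m+n (suc i) m)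
        time≤ : suc (4 + ((t + 4) + t′)) ≤ (9 + bound) + m * (9 + bound) + 5
        time≤ = begin
          suc (4 + ((t + 4) + t′))                  ≡⟨ reorder t t′ ⟩
          9 + t + t′                                ≤⟨ +-mono-≤ (+-monoʳ-≤ 9 t≤) t′≤ ⟩
          9 + bound + (m * (9 + bound) + 5)         ≡⟨ sym (+-assoc (9 + bound) _ 5) ⟩
          9 + bound + m * (9 + bound) + 5           ∎
          where
          open ≤-Reasoning
          reorder : ∀ t t′ → suc (4 + ((t + 4) + t′)) ≡ 9 + t + t′
          reorder = solve-∀

    branch : ∀ {r} (b : Cond r) (c d : Cmd r) {t} → t ≤ (stepFactor c + stepFactor d) * suc n ^ r →
             suc (costᵗ (compileᵗ b) + t) ≤ stepFactor (when b then c else d) * suc n ^ r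
    branch {r} b c d t≤ = ≤-trans (+-mono-≤ (const≤ (suc (costᵗ (compileᵗ b))) r) t≤)
      (≤-reflexive (sym (*-distribʳ-+ (suc n ^ r) (suc (costᵗ (compileᵗ b))) _)))

  simulates : ∀ {r} (c : Cmd r) → Simulates c
  simulates {r} skip {s} R = 1 , s , run-skip , const≤ 1 r , R
  simulates {r} (x at a ≔ b) {s} {ρ} {h} R = _ , _ , run-mem , const≤ (stepFactor (x at a ≔ b)) r ,
    subst₂ (λ l z → Represents r (setMem l z s) ρ (update x (eval a ρ h) (eval b ρ h) h))
      (sym (address-correct x (size-reg R) (eval-correct a R))) (sym (eval-correct b R))
      (setMem-represents x (eval a ρ h) (eval b ρ h) R)
  simulates {r} (c ⨾ d) R with simulates c R
  ... | t , s₁ , run₁ , t≤ , R₁ with simulates d R₁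
  ...   | t′ , s₂ , run₂ , t′≤ , R₂ = t + t′ , s₂ , run-seq run₁ run₂ ,
          ≤-trans (+-mono-≤ t≤ t′≤) (≤-reflexive
            (sym (*-distribʳ-+ (suc n ^ r) (stepFactor c) _))) , R₂
  simulates {r} (when b then c else d) {s} {ρ} {h} R with holds? b ρ h | test-correct b R
  ... | yes _ | eq with simulates c R
  ...   | t , s₁ , run₁ , t≤ , R₁ = _ , s₁ , run-then eq run₁ ,
          branch b c d (≤-trans t≤ (*-monoˡ-≤ (suc n ^ r)
            (m≤m+n (stepFactor c) (stepFactor d)))) , R₁
  simulates {r} (when b then c else d) {s} {ρ} {h} R | no _ | eq with simulates d R
  ...   | t , s₁ , run₁ , t≤ , R₁ = _ , s₁ , run-else eq run₁ ,
          branch b c d (≤-trans t≤ (*-monoˡ-≤ (suc n ^ r)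
            (m≤n+m (stepFactor d) (stepFactor c)))) , R₁
  simulates (for {r} c) {s} {ρ} {h} R
    with Loop.remaining c (simulates c) ρ n 0 {h = h} refl (setReg-represents (+ 0) R)
           (setReg-same (suc r) (+ 0) s)
  ... | t , s₁ , run₁ , t≤ , R₁ = _ , s₁ , run-seq run-reg run₁ , time≤ , R₁
    where
    X = suc n ^ r
    expand : ∀ K X n → 16 * X + n * 16 * X + (K * X + n * (K * X)) ≡ (16 + K) * ((1 + n) * X)
    expand = solve-∀
    regroup : ∀ B n → 2 + (n * (9 + B) + 5) ≡ (7 + n * 9) + n * B
    regroup = solve-∀
    time≤ : 2 + t ≤ (16 + stepFactor c) * (suc n * suc n ^ r)
    time≤ = begin
      2 + t                                       ≤⟨ +-monoʳ-≤ 2 t≤ ⟩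
      2 + (n * (9 + stepFactor c * X) + 5)        ≡⟨ regroup (stepFactor c * X) n ⟩
      (7 + n * 9) + n * (stepFactor c * X)        ≤⟨
        +-mono-≤ (+-mono-≤ (≤-trans (m≤m+n 7 9) (const≤ 16 r))
                                                       (≤-trans (*-monoʳ-≤ n (m≤m+n 9 7))
                                                         (const≤ (n * 16) r)))
                                                       (m≤n+m _ (stepFactor c * X)) ⟩
      16 * X + n * 16 * X + (stepFactor c * X + n * (stepFactor c * X))
        ≡⟨ expand (stepFactor c) X n ⟩
      (16 + stepFactor c) * (suc n * X)           ∎
      where open ≤-Reasoning

-- Counting and finite sums

private variable
  P Q R : ℕ → Set

count : Decidable P → ℕ → ℕ
count P? zero    = 0
count P? (suc n) = count P? n + bit (does (P? n))

sum : (ℕ → ℕ) → ℕ → ℕ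
sum f zero    = 0
sum f (suc k) = sum f k + f k

count-yes : ∀ (P? : Decidable P) {n} → P n → count P? (suc n) ≡ count P? n + 1
count-yes P? {n} p with P? n
... | yes _ = refl
... | no ¬p = contradiction p ¬p

count-no : ∀ (P? : Decidable P) {n} → ¬ P n → count P? (suc n) ≡ count P? n
count-no P? {n} ¬p with P? n
... | yes p = contradiction p ¬p
... | no _  = +-identityʳ _

count-⊎ : ∀ (P? : Decidable P) (Q? : Decidable Q) (R? : Decidable R) n →
          (∀ v → v < n → R v → P v ⊎ Q v) → count R? n ≤ count P? n + count Q? n
count-⊎ P? Q? R? zero    sub = z≤n
count-⊎ {P} {Q} {R} P? Q? R? (suc n) sub = begin
  count R? n + bit (does (R? n))                                          ≤⟨
    +-mono-≤ (count-⊎ P? Q? R? n (λ v v<n → sub v (m<n⇒m<1+n v<n))) last ⟩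
  count P? n + count Q? n + (bit (does (P? n)) + bit (does (Q? n)))       ≡⟨
    swap (count P? n) (count Q? n) _ _ ⟩
  count P? n + bit (does (P? n)) + (count Q? n + bit (does (Q? n)))       ∎
  where
  open ≤-Reasoning
  swap : ∀ a b c d → a + b + (c + d) ≡ a + c + (b + d)
  swap = solve-∀
  last : bit (does (R? n)) ≤ bit (does (P? n)) + bit (does (Q? n))
  last with R? n | P? n | Q? n
  ... | no _  | _      | _      = z≤n
  ... | yes _ | yes _  | _      = s≤s z≤n
  ... | yes _ | no _   | yes _  = ≤-refl
  ... | yes r | no ¬p  | no ¬q  = [ (λ p → contradiction p ¬p) , (λ q → contradiction q ¬q) ]′
    (sub n ≤-refl r)

count-disjoint : ∀ (P? : Decidable P) (Q? : Decidable Q) (R? : Decidable R) n →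
                 (∀ v → v < n → P v → R v) → (∀ v → v < n → Q v → R v) →
                 (∀ v → v < n → P v → Q v → ⊥) → count P? n + count Q? n ≤ count R? n
count-disjoint P? Q? R? zero    P⊆R Q⊆R dis = z≤n
count-disjoint P? Q? R? (suc n) P⊆R Q⊆R dis = begin
  count P? n + bit (does (P? n)) + (count Q? n + bit (does (Q? n)))       ≡⟨
    swap (count P? n) _ (count Q? n) _ ⟩
  count P? n + count Q? n + (bit (does (P? n)) + bit (does (Q? n)))       ≤⟨
    +-mono-≤ (count-disjoint P? Q? R? n
      (λ v v<n → P⊆R v (m<n⇒m<1+n v<n)) (λ v v<n → Q⊆R v (m<n⇒m<1+n v<n))
        (λ v v<n → dis v (m<n⇒m<1+n v<n))) last ⟩
  count R? n + bit (does (R? n))                                          ∎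
  where
  open ≤-Reasoning
  swap : ∀ a b c d → a + b + (c + d) ≡ a + c + (b + d)
  swap = solve-∀
  last : bit (does (P? n)) + bit (does (Q? n)) ≤ bit (does (R? n))
  last with P? n | Q? n | R? n
  ... | no _  | no _  | _     = z≤n
  ... | yes _ | no _  | yes _ = ≤-refl
  ... | no _  | yes _ | yes _ = ≤-refl
  ... | yes p | yes q | _     = ⊥-elim (dis n ≤-refl p q)
  ... | yes p | _     | no ¬r = contradiction (P⊆R n ≤-refl p) ¬r
  ... | _     | yes q | no ¬r = contradiction (Q⊆R n ≤-refl q) ¬r

count-mono : ∀ (P? : Decidable P) (Q? : Decidable Q) n →
             (∀ v → v < n → P v → Q v) → count P? n ≤ count Q? n
count-mono P? Q? zero    sub = z≤n
count-mono P? Q? (suc n) sub = +-mono-≤ (count-mono P? Q? n (λ v v<n → sub v (m<n⇒m<1+n v<n))) last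
  where
  last : bit (does (P? n)) ≤ bit (does (Q? n))
  last with P? n | Q? n
  ... | no _  | _     = z≤n
  ... | yes _ | yes _ = ≤-refl
  ... | yes p | no ¬q = contradiction (sub n ≤-refl p) ¬q

count-cong : ∀ (P? : Decidable P) (Q? : Decidable Q) n →
             (∀ v → v < n → P v → Q v) → (∀ v → v < n → Q v → P v) → count P? n ≡ count Q? n
count-cong P? Q? n to from = ≤-antisym (count-mono P? Q? n to) (count-mono Q? P? n from)

count-≤ : ∀ (P? : Decidable P) n → count P? n ≤ n
count-≤ P? zero    = z≤n
count-≤ P? (suc n) with P? n
... | yes _ = subst (_≤ suc n) (+-comm 1 _) (s≤s (count-≤ P? n))
... | no _  = subst (_≤ suc n) (sym (+-identityʳ _)) (m≤n⇒m≤1+n (count-≤ P? n))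

count-all : ∀ (P? : Decidable P) n → (∀ v → v < n → P v) → count P? n ≡ n
count-all P? zero    all = refl
count-all P? (suc n) all = trans (count-yes P? (all n ≤-refl))
  (trans (+-comm _ 1) (cong suc (count-all P? n (λ v v<n → all v (m<n⇒m<1+n v<n)))))

count-none : ∀ (P? : Decidable P) n → (∀ v → v < n → ¬ P v) → count P? n ≡ 0
count-none P? zero    none = refl
count-none P? (suc n) none = trans (count-no P? (none n ≤-refl))
  (count-none P? n (λ v v<n → none v (m<n⇒m<1+n v<n)))

count-monoʳ : ∀ (P? : Decidable P) {m n} → m ≤ n → count P? m ≤ count P? n
count-monoʳ P? {m} {n} m≤n = go (≤⇒≤‴ m≤n)
  where
  go : ∀ {m} → m ≤‴ n → count P? m ≤ count P? n
  go ≤‴-refl        = ≤-refl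
  go (≤‴-step m<n) = ≤-trans (m≤m+n _ _) (go m<n)

count-< : ∀ (P? : Decidable P) {m n} → m < n → P m → count P? m < count P? n
count-< P? {m} m<n p = ≤-trans (≤-reflexive (trans (+-comm 1 _) (sym (count-yes P? p))))
  (count-monoʳ P? m<n)

-- Double counting by color: passing from k to k + 1 adds exactly the disjoint class of color k.
sum-count : ∀ (P? : Decidable P) (c : ℕ → ℕ) n k →
            sum (λ j → count (λ v → P? v ×-dec (c v ≟ j)) n) k ≡ count
              (λ v → P? v ×-dec (c v <? k)) n
sum-count P? c n zero    = sym (count-none (λ v → P? v ×-dec (c v <? 0)) n (λ v _ → n≮0 ∘ proj₂))
sum-count P? c n (suc k) = trans (cong (λ z → z + count (λ v → P? v ×-dec (c v ≟ k)) n)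
  (sum-count P? c n k))
  (≤-antisym
    (count-disjoint (λ v → P? v ×-dec (c v <? k)) (λ v → P? v ×-dec (c v ≟ k))
      (λ v → P? v ×-dec (c v <? suc k)) n
      (λ v _ (p , q) → p , m<n⇒m<1+n q) (λ { v _ (p , refl) → p , ≤-refl })
        (λ v _ (_ , q) (_ , r) → <⇒≢ q r))
    (count-⊎ (λ v → P? v ×-dec (c v <? k)) (λ v → P? v ×-dec (c v ≟ k))
      (λ v → P? v ×-dec (c v <? suc k)) n
      (λ v _ (p , q) → [ (λ lt → inj₁ (p , lt)) , (λ eq → inj₂ (p , eq)) ]′ (m<1+n⇒m<n∨m≡n q))))

sum-mono : ∀ (f g : ℕ → ℕ) k → (∀ j → j < k → f j ≤ g j) → sum f k ≤ sum g k
sum-mono f g zero    le = z≤n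
sum-mono f g (suc k) le = +-mono-≤ (sum-mono f g k (λ j j<k → le j (m<n⇒m<1+n j<k))) (le k ≤-refl)

sum-+ : ∀ (f g : ℕ → ℕ) k → sum (λ j → f j + g j) k ≡ sum f k + sum g k
sum-+ f g zero    = refl
sum-+ f g (suc k) = trans (cong (λ z → z + (f k + g k)) (sum-+ f g k))
  (swap (sum f k) (sum g k) (f k) (g k))
  where
  swap : ∀ a b c d → a + b + (c + d) ≡ a + c + (b + d)
  swap = solve-∀

sum-monoʳ : ∀ (f : ℕ → ℕ) {k l} → k ≤ l → sum f k ≤ sum f l
sum-monoʳ f {k} {l} k≤l = go (≤⇒≤‴ k≤l)
  where
  go : ∀ {k} → k ≤‴ l → sum f k ≤ sum f l
  go ≤‴-refl        = ≤-refl
  go (≤‴-step k<l) = ≤-trans (m≤m+n _ _) (go k<l)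

sum-tail-≥ : ∀ (f : ℕ → ℕ) q d s → (∀ j → q ≤ j → j < q + d → s ≤ f j) →
  sum f q + d * s ≤ sum f (q + d)
sum-tail-≥ f q zero    s le = ≤-reflexive (trans (+-identityʳ _)
  (cong (sum f) (sym (+-identityʳ q))))
sum-tail-≥ f q (suc d) s le rewrite +-suc q d = begin
  sum f q + (s + d * s)  ≡⟨ shift (sum f q) s (d * s) ⟩
  sum f q + d * s + s    ≤⟨ +-mono-≤ (sum-tail-≥ f q d s
    (λ j q≤j j<q+d → le j q≤j (m<n⇒m<1+n j<q+d)))
                              (le (q + d) (m≤m+n q d) ≤-refl) ⟩
  sum f (q + d) + f (q + d) ∎
  where
  open ≤-Reasoning
  shift : ∀ a b c → a + (b + c) ≡ a + c + b
  shift = solve-∀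

sum-tail-0 : ∀ (f : ℕ → ℕ) q d → (∀ j → q ≤ j → j < q + d → f j ≡ 0) → sum f (q + d) ≡ sum f q
sum-tail-0 f q zero    eq = cong (sum f) (+-identityʳ q)
sum-tail-0 f q (suc d) eq rewrite +-suc q d | eq (q + d) (m≤m+n q d) ≤-refl =
  trans (+-identityʳ _) (sum-tail-0 f q d (λ j q≤j j<q+d → eq j q≤j (m<n⇒m<1+n j<q+d)))

-- A deficit in one term could not be made up by the others. This turns "no class exceeds its
-- capacity and everything is placed" into exact class sizes.
sum-tight : ∀ (f g : ℕ → ℕ) k → (∀ j → j < k → f j ≤ g j) → sum g k ≤ sum f k →
            ∀ j → j < k → g j ≤ f j
sum-tight f g (suc k) le tight j j<1+k with m<1+n⇒m<n∨m≡n j<1+k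
... | inj₁ j<k  = sum-tight f g k le′ (+-cancelʳ-≤ (f k)
  _ _ (≤-trans (+-monoʳ-≤ (sum g k) (le k ≤-refl)) tight)) j j<k
  where le′ = λ i i<k → le i (m<n⇒m<1+n i<k)
... | inj₂ refl = +-cancelˡ-≤ (sum f k) _ _ (≤-trans
  (+-monoˡ-≤ (g k) (sum-mono f g k (λ i i<k → le i (m<n⇒m<1+n i<k)))) tight)

-- With A as adjacency and U as the smaller-side part of one class, this bounds the number of
-- vertices that the class can refuse. The induction splits off the last potential neighbour m.
union-bound : ∀ {A : ℕ → ℕ → Set} {U : ℕ → Set} (A? : ∀ u → Decidable (A u)) (U? : Decidable U)
  (Q? : Decidable Q) n D m →
              (∀ u → u < m → count (A? u) n ≤ D) →
              (∀ v → v < n → Q v → ∃[ u ] (u < m × U u × A u v)) → count Q? n ≤ count U? m * D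
union-bound A? U? Q? n D zero deg cover =
  ≤-reflexive (count-none Q? n (λ v v<n q → n≮0 (proj₁ (proj₂ (cover v v<n q)))))
union-bound {Q} {A} {U} A? U? Q? n D (suc m) deg cover = begin
  count Q? n                                  ≤⟨ count-⊎ rest? last? Q? n split ⟩
  count rest? n + count last? n               ≤⟨
    +-mono-≤ (union-bound A? U? rest? n D m (λ u u<m → deg u (m<n⇒m<1+n u<m)) (λ v _ → id))
    (last≤ (U? m)) ⟩
  count U? m * D + bit (does (U? m)) * D      ≡⟨ sym (*-distribʳ-+ D (count U? m) _) ⟩
  count U? (suc m) * D                        ∎
  where
  open ≤-Reasoning
  rest? : Decidable (λ v → ∃[ u ] (u < m × U u × A u v))
  rest? v = anyUpTo? (λ u → U? u ×-dec A? u v) m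
  last? : Decidable (λ v → U m × A m v)
  last? v = U? m ×-dec A? m v
  split : ∀ v → v < n → Q v → (∃[ u ] (u < m × U u × A u v)) ⊎ (U m × A m v)
  split v v<n q with cover v v<n q
  ... | u , u<1+m , uu , auv with m<1+n⇒m<n∨m≡n u<1+m
  ...   | inj₁ u<m  = inj₁ (u , u<m , uu , auv)
  ...   | inj₂ refl = inj₂ (uu , auv)
  last≤ : (d : Dec (U m)) → count last? n ≤ bit (does d) * D
  last≤ (no ¬u) = ≤-reflexive (count-none last? n (λ v _ (u , _) → ¬u u))
  last≤ (yes _) = begin
    count last? n      ≤⟨ count-mono last? (A? m) n (λ v _ → proj₂) ⟩
    count (A? m) n     ≤⟨ deg m ≤-refl ⟩
    D                  ≡⟨ sym (+-identityʳ D) ⟩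
    D + 0              ∎

-- Class sizes and first fit

quot-lower : ∀ x {y} → 0 < y → quot x y * y ≤ x
quot-lower x {suc y} _ = m/n*n≤m x (suc y)

quot-upper : ∀ x {y} → 0 < y → x < suc (quot x y) * y
quot-upper x {suc y} _ = begin-strict
  x                                       ≡⟨ m≡m%n+[m/n]*n x (suc y) ⟩
  x % suc y + x ℕ./ suc y * suc y           <⟨ +-monoˡ-< _ (m%n<n x (suc y)) ⟩
  suc y + x ℕ./ suc y * suc y               ∎
  where open ≤-Reasoning

≤-quot : ∀ {q x y} → 0 < y → q * y ≤ x → q ≤ quot x y
≤-quot {q} {x} {y} 0<y le = ≮⇒≥ λ lt →
  <⇒≱ (quot-upper x 0<y) (≤-trans (*-monoˡ-≤ y lt) le)

quot-< : ∀ {q x y} → 0 < y → x < q * y → quot x y < q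
quot-< {q} {x} {y} 0<y lt = ≰⇒> λ le →
  <⇒≱ lt (≤-trans (*-monoˡ-≤ y le) (quot-lower x 0<y))

crossing : ∀ (S : ℕ → ℕ) {m} k → S 0 ≤ m → m < S k → ∃[ p ] (p < k × S p ≤ m × m < S (suc p))
crossing S zero    S₀≤m m<S₀ = contradiction S₀≤m (<⇒≱ m<S₀)
crossing S {m} (suc k) S₀≤m m<S with m <? S k
... | no m≮S  = k , ≤-refl , ≮⇒≥ m≮S , m<S
... | yes m<S′ with crossing S k S₀≤m m<S′
...   | p , p<k , rest = p , m<n⇒m<1+n p<k , rest

find-< : ∀ (f g : ℕ → ℕ) k → sum f k < sum g k → ∃[ j ] (j < k × f j < g j)
find-< f g k lt with anyUpTo? (λ j → f j <? g j) k
... | yes found = found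
... | no none   = contradiction (sum-mono g f k (λ j j<k → ≮⇒≥ (λ f<g → none (j , j<k , f<g))))
  (<⇒≱ lt)

-- Class j is to receive S (j + 1) - S j of the n vertices.  The classes with
-- S (j + 1) ≤ m are filled with vertices of the smaller side, which has m vertices;
-- every other class takes at most an eighth of its size from that side.
module Classes (n k D m : ℕ) where

  classMin : ℕ
  classMin = quot n k

  share : ℕ
  share = quot classMin 8

  -- Cutting the interval from 0 to n at the points ⌊jn/k⌋ gives pieces of length s or s + 1 that
  -- add up to n, with no separate treatment of the remainder of n modulo k.
  S : ℕ → ℕ
  S j = quot (j * n) k

  cap : ℕ → ℕ
  cap j = S (suc j) ∸ S j

  quota : ℕ → ℕ
  quota j = if does (S (suc j) ≤? m) then cap j else share

  -- The two inequalities on 2k express k = ⌈D/2⌉ + 1 without rounding, and m stands for the size of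
  -- the smaller side.
  module Bounds (200≤D : 200 ≤ D) (20D≤n : 20 * D ≤ n) (D+2≤2k : D + 2 ≤ 2 * k)
    (2k≤D+3 : 2 * k ≤ D + 3)
                (2m≤n : 2 * m ≤ n) where
    open ≤-Reasoning

    101≤k : 101 ≤ k
    101≤k = *-cancelˡ-≤ 2 (begin
      202     ≤⟨ +-monoˡ-≤ 2 200≤D ⟩
      D + 2   ≤⟨ D+2≤2k ⟩
      2 * k   ∎)

    0<k : 0 < k
    0<k = ≤-trans (m≤m+n 1 100) 101≤k

    -- Guarantees s ≥ 8 and hence a positive share.
    8k≤n : 8 * k ≤ n
    8k≤n = begin
      8 * k             ≡⟨ *-assoc 4 2 k ⟩
      4 * (2 * k)       ≤⟨ *-monoʳ-≤ 4 2k≤D+3 ⟩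
      4 * (D + 3)       ≤⟨ *-monoʳ-≤ 4 (+-monoʳ-≤ D (≤-trans (m≤m+n 3 197) 200≤D)) ⟩
      4 * (D + D)       ≡⟨ double D ⟩
      8 * D             ≤⟨ *-monoˡ-≤ D (m≤m+n 8 12) ⟩
      20 * D            ≤⟨ 20D≤n ⟩
      n                 ∎
      where
      double : ∀ D → 4 * (D + D) ≡ 8 * D
      double = solve-∀

    8≤classMin : 8 ≤ classMin
    8≤classMin = ≤-quot 0<k 8k≤n

    0<share : 0 < share
    0<share = ≤-quot {1} {classMin} {8} (s≤s z≤n) 8≤classMin

    8share≤classMin : share * 8 ≤ classMin
    8share≤classMin = quot-lower classMin (s≤s z≤n)

    -- Rounding s/8 down loses less than 1, hence less than the share itself, which is at least 1.
    -- So doubling 8 to 16 compensates for the rounding.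
    classMin<16share : suc classMin ≤ 16 * share
    classMin<16share = begin
      suc classMin       ≤⟨ quot-upper classMin {8} (s≤s z≤n) ⟩
      8 + share * 8      ≤⟨ +-monoˡ-≤ (share * 8) (*-monoˡ-≤ 8 0<share) ⟩
      share * 8 + share * 8 ≡⟨ double share ⟩
      16 * share         ∎
      where
      double : ∀ D → D * 8 + D * 8 ≡ 16 * D
      double = solve-∀

    S-lower : ∀ j → S j + classMin ≤ S (suc j)
    S-lower j = ≤-quot 0<k (begin
      (S j + classMin) * k       ≡⟨ *-distribʳ-+ k (S j) classMin ⟩
      S j * k + classMin * k     ≤⟨ +-mono-≤ (quot-lower (j * n) 0<k) (quot-lower n 0<k) ⟩
      j * n + n                  ≡⟨ +-comm (j * n) n ⟩
      suc j * n                  ∎)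

    S-upper : ∀ j → S (suc j) ≤ S j + suc classMin
    S-upper j = s≤s⁻¹ (subst (S (suc j) <_) (+-suc (S j) (suc classMin)) (quot-< 0<k (begin-strict
      n + j * n                                ≡⟨ +-comm n (j * n) ⟩
      j * n + n                                <⟨
        +-mono-< (quot-upper (j * n) 0<k) (quot-upper n 0<k) ⟩
      suc (S j) * k + suc classMin * k         ≡⟨ regroup (S j) classMin k ⟩
      (S j + suc (suc classMin)) * k           ∎)))
      where
      regroup : ∀ a b k → suc a * k + suc b * k ≡ (a + suc (suc b)) * k
      regroup = solve-∀

    S-suc : ∀ j → S j ≤ S (suc j)
    S-suc j = ≤-trans (m≤m+n (S j) classMin) (S-lower j)

    S-mono : ∀ {i j} → i ≤ j → S i ≤ S j
    S-mono {j = j} i≤j = go (≤⇒≤‴ i≤j)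
      where
      go : ∀ {i} → i ≤‴ j → S i ≤ S j
      go ≤‴-refl              = ≤-refl
      go {i} (≤‴-step i<j) = ≤-trans (S-suc i) (go i<j)

    S-zero : S 0 ≡ 0
    S-zero = n≤0⇒n≡0 (s≤s⁻¹ (quot-< 0<k (≤-trans 0<k (m≤m+n k 0))))

    S-k : S k ≡ n
    S-k = ≤-antisym (s≤s⁻¹ (quot-< 0<k (subst (_< suc n * k) (*-comm n k) (+-monoˡ-< (n * k) 0<k))))
            (≤-quot 0<k (≤-reflexive (*-comm n k)))

    classMin≤cap : ∀ j → classMin ≤ cap j
    classMin≤cap j = subst (_≤ cap j) (m+n∸m≡n (S j) classMin) (∸-monoˡ-≤ (S j) (S-lower j))

    cap≤1+classMin : ∀ j → cap j ≤ suc classMin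
    cap≤1+classMin j = subst (cap j ≤_) (m+n∸m≡n (S j) (suc classMin)) (∸-monoˡ-≤ (S j) (S-upper j))

    sum-cap : ∀ j → sum cap j ≡ S j
    sum-cap zero    = sym S-zero
    sum-cap (suc j) = trans (cong (λ z → z + cap j) (sum-cap j)) (m+[n∸m]≡n (S-suc j))

    below-cap : ∀ {x} j → x + S j < S (suc j) → x < cap j
    below-cap {x} j lt = subst (_≤ cap j) (m+n∸n≡m (suc x) (S j)) (∸-monoˡ-≤ (S j) lt)

    not-below-cap : ∀ {x} j → ¬ (x + S j < S (suc j)) → cap j ≤ x
    not-below-cap {x} j ¬lt = subst (cap j ≤_) (m+n∸n≡m x (S j)) (∸-monoˡ-≤ (S j) (≮⇒≥ ¬lt))

    quota-pure : ∀ j → S (suc j) ≤ m → quota j ≡ cap j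
    quota-pure j le with S (suc j) ≤ᵇ m in eq
    ... | true  = refl
    ... | false = ⊥-elim (subst T eq (≤⇒≤ᵇ le))

    quota-mixed : ∀ j → ¬ (S (suc j) ≤ m) → quota j ≡ share
    quota-mixed j ¬le with S (suc j) ≤ᵇ m in eq
    ... | true  = contradiction (≤ᵇ⇒≤ _ _ (subst T (sym eq) _)) ¬le
    ... | false = refl

    share≤cap : ∀ j → share ≤ cap j
    share≤cap j = ≤-trans (≤-trans (m≤m*n share 8) 8share≤classMin) (classMin≤cap j)

    quota≤cap : ∀ j → quota j ≤ cap j
    quota≤cap j with S (suc j) ≤ᵇ m
    ... | true  = ≤-refl
    ... | false = share≤cap j

    private abstract
      2k≤n : 2 * k ≤ n
      2k≤n = ≤-trans (*-monoˡ-≤ k (m≤m+n 2 6)) 8k≤n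

      0<n : 0 < n
      0<n = ≤-trans 0<k (≤-trans (m≤m+n k (k + 0)) 2k≤n)

      m<n : m < n
      m<n = *-cancelˡ-< 2 m n (≤-<-trans 2m≤n
        (subst (n <_) (cong (λ z → n + z) (sym (+-identityʳ n))) (m<m+n n 0<n)))

      boundary : ∃[ p ] (p < k × S p ≤ m × m < S (suc p))
      boundary = crossing S k (subst (_≤ m) (sym S-zero) z≤n) (subst (m <_) (sym S-k) m<n)

    -- The number of classes reserved entirely for the smaller side: the last cut point not beyond m
    -- is `S p₀`.
    p₀ : ℕ
    p₀ = proj₁ boundary

    private
      S-p₀≤m : S p₀ ≤ m
      S-p₀≤m = proj₁ (proj₂ (proj₂ boundary))

      m<S-1+p₀ : m < S (suc p₀)
      m<S-1+p₀ = proj₂ (proj₂ (proj₂ boundary))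

      -- The reserved classes hold at most m ≤ n/2 vertices. Undoing the floor in `S p₀` costs an
      -- extra 2k, which is absorbed by one n, and strictness then removes the excess 1.
      2p₀≤k : 2 * p₀ ≤ k
      2p₀≤k = s≤s⁻¹ (*-cancelʳ-< n (2 * p₀) (suc k) (begin-strict
        2 * p₀ * n              ≡⟨ *-assoc 2 p₀ n ⟩
        2 * (p₀ * n)            <⟨ *-monoʳ-< 2 (<-≤-trans (quot-upper (p₀ * n) 0<k)
          (*-monoˡ-≤ k (s≤s S-p₀≤m))) ⟩
        2 * (suc m * k)         ≡⟨ expand m k ⟩
        2 * k + 2 * m * k       ≤⟨ +-mono-≤ 2k≤n (*-monoˡ-≤ k 2m≤n) ⟩
        n + n * k               ≡⟨ cong (λ z → n + z) (*-comm n k) ⟩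
        suc k * n               ∎))
        where
        expand : ∀ m k → 2 * (suc m * k) ≡ 2 * k + 2 * m * k
        expand = solve-∀

      p₀+16≤k : p₀ + 16 ≤ k
      p₀+16≤k = *-cancelˡ-≤ 2 (begin
        2 * (p₀ + 16)     ≡⟨ *-distribˡ-+ 2 p₀ 16 ⟩
        2 * p₀ + 32       ≤⟨ +-mono-≤ 2p₀≤k (≤-trans (m≤m+n 32 69) 101≤k) ⟩
        k + k             ≡⟨ cong (λ z → k + z) (sym (+-identityʳ k)) ⟩
        2 * k             ∎)

      -- The number of classes behind the sixteen mixed ones, which the smaller side never reaches.
      d : ℕ
      d = k ∸ (p₀ + 16)

      p₀+16+d≡k : p₀ + 16 + d ≡ k
      p₀+16+d≡k = m+[n∸m]≡n p₀+16≤k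

      k≤32+2d : k ≤ 32 + 2 * d
      k≤32+2d = +-cancelˡ-≤ k _ _ (begin
        k + k                         ≡⟨ cong (λ z → k + z) (sym (+-identityʳ k)) ⟩
        2 * k                         ≡⟨ cong (2 *_) (sym p₀+16+d≡k) ⟩
        2 * (p₀ + 16 + d)             ≡⟨ expand p₀ 16 d ⟩
        2 * p₀ + (32 + 2 * d)         ≤⟨ +-monoˡ-≤ _ 2p₀≤k ⟩
        k + (32 + 2 * d)              ∎)
        where
        expand : ∀ p q d → 2 * (p + q + d) ≡ 2 * p + (2 * q + 2 * d)
        expand = solve-∀

      D+2≤64+4d : D + 2 ≤ 64 + 4 * d
      D+2≤64+4d = begin
        D + 2              ≤⟨ D+2≤2k ⟩
        2 * k              ≤⟨ *-monoʳ-≤ 2 k≤32+2d ⟩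
        2 * (32 + 2 * d)   ≡⟨ *-distribˡ-+ 2 32 (2 * d) ⟩
        64 + 2 * (2 * d)   ≡⟨ cong (λ z → 64 + z) (sym (*-assoc 2 2 d)) ⟩
        64 + 4 * d         ∎

      -- Since at most half of the classes are reserved, D + 2 ≤ 64 + 4d. For D ≥ 200 this forces 4d
      -- ≥ 138, so the constant 64 is absorbed by a second 4d.
      D<8d : D < d * 8
      D<8d = begin-strict
        D                 <⟨ m<m+n D (s≤s z≤n) ⟩
        D + 2             ≤⟨ D+2≤64+4d ⟩
        64 + 4 * d        ≤⟨ +-monoˡ-≤ (4 * d) (≤-trans (m≤m+n 64 74) 138≤4d) ⟩
        4 * d + 4 * d     ≡⟨ expand d ⟩
        d * 8             ∎
        where
        138≤4d : 138 ≤ 4 * d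
        138≤4d = +-cancelˡ-≤ 64 138 (4 * d) (≤-trans (+-monoˡ-≤ 2 200≤D) D+2≤64+4d)
        expand : ∀ d → 4 * d + 4 * d ≡ d * 8
        expand = solve-∀

      -- The decisive inequality: on the left the most neighbours that the smaller-side part of a
      -- mixed class can have, on the right the least number of vertices in d full classes. The 8 of
      -- `D<8d` cancels against the 8 in the share.
      shareD<d·classMin : share * D < d * classMin
      shareD<d·classMin = begin-strict
        share * D            <⟨ *-monoʳ-< share ⦃ >-nonZero 0<share ⦄ D<8d ⟩
        share * (d * 8)      ≡⟨ swap share d ⟩
        d * (share * 8)      ≤⟨ *-monoʳ-≤ d 8share≤classMin ⟩
        d * classMin         ∎
        where
        swap : ∀ g d → g * (d * 8) ≡ d * (g * 8)
        swap = solve-∀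

      pure-below : ∀ {j} → j < p₀ → S (suc j) ≤ m
      pure-below j<p₀ = ≤-trans (S-mono j<p₀) S-p₀≤m

      mixed-above : ∀ {j} → p₀ ≤ j → ¬ (S (suc j) ≤ m)
      mixed-above p₀≤j = <⇒≱ (<-≤-trans m<S-1+p₀ (S-mono (s≤s p₀≤j)))

      cap≤quota : ∀ {j} → j < p₀ → cap j ≤ quota j
      cap≤quota {j} j<p₀ = ≤-reflexive (sym (quota-pure j (pure-below j<p₀)))

    -- The reserved classes take `S p₀` vertices; fewer than s + 1 remain, and sixteen shares hold
    -- them. Strictness provides room for one more vertex.
    m<quotas : m < sum quota (p₀ + 16)
    m<quotas = begin-strict
      m                               <⟨ m<S-1+p₀ ⟩
      S (suc p₀)                      ≤⟨ S-upper p₀ ⟩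
      S p₀ + suc classMin             ≤⟨ +-monoʳ-≤ (S p₀) classMin<16share ⟩
      S p₀ + 16 * share               ≡⟨ cong (λ z → z + 16 * share) (sym (sum-cap p₀)) ⟩
      sum cap p₀ + 16 * share         ≤⟨ +-monoˡ-≤ (16 * share)
        (sum-mono cap quota p₀ (λ j j<p₀ → cap≤quota j<p₀)) ⟩
      sum quota p₀ + 16 * share       ≤⟨ sum-tail-≥ quota p₀ 16 share
        (λ j p₀≤j _ → ≤-reflexive (sym (quota-mixed j (mixed-above p₀≤j)))) ⟩
      sum quota (p₀ + 16)             ∎

    -- Here `c j` is the number of smaller-side vertices in class j. All that is retained of the
    -- order of placement is that a class is entered only after every earlier one has met its quota.
    module FirstFit (c : ℕ → ℕ) (c≤quota : ∀ j → j < k → c j ≤ quota j)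
                    (first-fit : ∀ i j → i < j → j < k → 0 < c j → quota i ≤ c i)
                    where

      room : sum c k ≤ m → ∃[ j ] (j < k × c j < quota j)
      room sum≤m =
        let j , j<p₀+16 , lt = find-< c quota (p₀ + 16)
              (≤-<-trans (sum-monoʳ c p₀+16≤k) (≤-<-trans sum≤m m<quotas))
        in j , <-≤-trans j<p₀+16 p₀+16≤k , lt

      -- A vertex this far out would mean that the first p₀ + 16 quotas are all met, which takes
      -- more than m vertices.
      empty-above : sum c k ≤ m → ∀ {j} → j < k → p₀ + 16 ≤ j → c j ≡ 0
      empty-above sum≤m {j} j<k p₀+16≤j = n≤0⇒n≡0 (≮⇒≥ λ 0<c →
        <⇒≱ m<quotas (begin
          sum quota (p₀ + 16)    ≤⟨ sum-monoʳ quota p₀+16≤j ⟩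
          sum quota j            ≤⟨ sum-mono quota c j (λ i i<j → first-fit i j i<j j<k 0<c) ⟩
          sum c j                ≤⟨ sum-monoʳ c (<⇒≤ j<k) ⟩
          sum c k                ≤⟨ sum≤m ⟩
          m                      ∎))

      -- If class j were not full, first fit would leave all later classes empty, and the classes up
      -- to j would hold fewer than `S (suc j)`, hence fewer than m vertices.
      pure-full : sum c k ≡ m → ∀ {j} → j < k → j < p₀ → cap j ≤ c j
      pure-full sum≡m {j} j<k j<p₀ = ≮⇒≥ λ c<cap → <-irrefl sum≡m (begin-strict
        sum c k                        ≡⟨ cong (sum c) (sym (m+[n∸m]≡n j<k)) ⟩
        sum c (suc j + (k ∸ suc j))    ≡⟨ sum-tail-0 c (suc j) (k ∸ suc j) (rest-empty c<cap) ⟩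
        sum c j + c j                  <⟨ +-mono-≤-< (sum-mono c cap j below) c<cap ⟩
        sum cap j + cap j              ≡⟨ sum-cap (suc j) ⟩
        S (suc j)                      ≤⟨ pure-below j<p₀ ⟩
        m                              ∎)
        where
        below : ∀ i → i < j → c i ≤ cap i
        below i i<j = ≤-trans (c≤quota i (<-trans i<j j<k)) (quota≤cap i)
        rest-empty : c j < cap j → ∀ i → suc j ≤ i → i < suc j + (k ∸ suc j) → c i ≡ 0
        rest-empty c<cap i j<i i<k = n≤0⇒n≡0 (≮⇒≥ λ 0<c →
          <⇒≱ c<cap (≤-trans (cap≤quota j<p₀)
            (first-fit j i j<i (subst (i <_) (m+[n∸m]≡n j<k) i<k) 0<c)))

      -- If a vertex of the larger side is stuck, some class j with room contains a
      -- neighbour of it.  Such a class is mixed, so few vertices are adjacent to its part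
      -- in the smaller side; but the classes from p₀ + 16 on contain too many vertices
      -- that were refused by class j.
      not-stuck : sum c k ≡ m → (l : ℕ → ℕ) → sum (λ j → c j + l j) k < n →
                  (∀ j → j < k → cap j ≤ c j + l j ⊎
                    (0 < c j × sum l k ≤ sum l (suc j) + c j * D)) → ⊥
      not-stuck sum≡m l total<n blocked =
        let j , j<k , room-j = find-< (λ j → c j + l j) cap k
              (subst (sum (λ j → c j + l j) k <_) (trans (sym S-k) (sym (sum-cap k))) total<n)
        in [ <⇒≱ room-j , refused j<k room-j ]′ (blocked j j<k)
        where
        sum≤m : sum c k ≤ m
        sum≤m = ≤-reflexive sum≡m
        -- Such a class has no vertex of the smaller side, so it cannot have refused anything; being
        -- blocked, it must be full, and only of vertices of the larger side.
        above : ∀ i → p₀ + 16 ≤ i → i < p₀ + 16 + d → classMin ≤ l i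
        above i le i< = [ (λ full → ≤-trans (classMin≤cap i)
          (subst (λ z → cap i ≤ z + l i) c≡0 full))
                        , (λ { (0<c , _) → contradiction (sym c≡0) (<⇒≢ 0<c) }) ]′ (blocked i i<k)
          where
          i<k = subst (i <_) p₀+16+d≡k i<
          c≡0 = empty-above sum≤m i<k le
        refused : ∀ {j} → j < k → c j + l j < cap j →
          ¬ (0 < c j × sum l k ≤ sum l (suc j) + c j * D)
        refused {j} j<k room-j (0<c , few) = <⇒≱ shareD<d·classMin
          (+-cancelˡ-≤ (sum l (p₀ + 16)) _ _ (begin
          sum l (p₀ + 16) + d * classMin   ≤⟨ sum-tail-≥ l (p₀ + 16) d classMin above ⟩
          sum l (p₀ + 16 + d)              ≡⟨ cong (sum l) p₀+16+d≡k ⟩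
          sum l k                          ≤⟨ few ⟩
          sum l (suc j) + c j * D          ≤⟨ +-mono-≤ (sum-monoʳ l j<p₀+16) (*-monoˡ-≤ D c≤share) ⟩
          sum l (p₀ + 16) + share * D      ∎))
          where
          j<p₀+16 : j < p₀ + 16
          j<p₀+16 = ≰⇒> λ le → <⇒≢ 0<c (sym (empty-above sum≤m j<k le))
          p₀≤j : p₀ ≤ j
          p₀≤j = ≮⇒≥ λ j<p₀ → <⇒≱ room-j (≤-trans (pure-full sum≡m j<k j<p₀) (m≤m+n (c j) (l j)))
          c≤share : c j ≤ share
          c≤share = subst (c j ≤_) (quota-mixed j (mixed-above p₀≤j)) (c≤quota j j<k)

-- The algorithm

color comp side hit bad cnt tally deg maxDeg flag classes share best : Name
color   = # 0
comp    = # 1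
side    = # 2
hit     = # 3
bad     = # 4
cnt     = # 5
tally   = # 6
deg     = # 7
maxDeg  = # 8
flag    = # 9
classes = # 10
share   = # 11
best    = # 12

infix 9 ![_]

-- Scalar variables are arrays of which only cell 0 is used.
![_] : ∀ {r} → Name → Exp r
![ x ] = x at num 0

infix 3 ![_]≔_

![_]≔_ : ∀ {r} → Name → Exp r → Cmd r
![ x ]≔ e = x at num 0 ≔ e

infix 5 _<′_
_<′_ : ∀ {r} → Exp r → Exp r → Cond r
a <′ b = num 1 +′ a ≤′ b

outer : ∀ {r} {_ : True (r ≤? 1)} → Exp r
outer {_} {r≤1} = ctr 1 {r≤1}

inner : Exp 0
inner = ctr 0

countNeighbour : Cmd 0
countNeighbour = when edge 1 0 then ![ deg ]≔ ![ deg ] +′ num 1 else skip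

degreeStep : Cmd 1
degreeStep =
  ![ deg ]≔ num 0 ⨾
  for countNeighbour ⨾
  (when ![ maxDeg ] ≤′ ![ deg ] then ![ maxDeg ]≔ ![ deg ] else skip)

maximumDegree : Cmd 2
maximumDegree = for degreeStep

resetHit : Cmd 0
resetHit = hit at inner ≔ num 0

-- The value 0 means that the component is not adjacent to the current vertex; otherwise 1 + the
-- side of its neighbours is stored. Bipartiteness makes this side the same for all neighbours in
-- one component, so overwriting is harmless.
markHit : Cmd 0
markHit = when inner <′ outer and edge 0 1
          then hit at (comp at inner) ≔ num 1 +′ side at inner
          else skip

-- Vertices on the same side as the neighbours of the current vertex go to side 1, opposite to that
-- vertex. The component name is replaced last because the test looks up `hit` under the old name.
relabel : Cmd 0
relabel = when inner <′ outer and num 1 ≤′ hit at (comp at inner)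
          then ((when num 1 +′ side at inner ≡′ hit at (comp at inner)
                 then side at inner ≔ num 1
                 else side at inner ≔ num 0) ⨾
                comp at inner ≔ outer)
          else skip

-- The vertices before the current one carry the name of their component and their
-- side in a bipartition of it.  The components adjacent to the current vertex are
-- merged under the name of that vertex, which is put on side 0.
bipartitionStep : Cmd 1
bipartitionStep =
  for resetHit ⨾
  for markHit ⨾
  for relabel ⨾
  comp at outer ≔ outer ⨾
  side at outer ≔ num 0

bipartition : Cmd 2
bipartition = for bipartitionStep

tallyStep : Cmd 1
tallyStep = tally at (side at outer) ≔ tally at (side at outer) +′ num 1

smallerSide : Cmd 2
smallerSide =
  for tallyStep ⨾
  (when tally at num 1 ≤′ tally at num 0 then ![ flag ]≔ num 1 else ![ flag ]≔ num 0)

-- Correctness of degrees, bipartition and side sizes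

adjacent? : ∀ (E : ℕ → ℕ → Bool) u → Decidable (λ v → E u v ≡ true)
adjacent? E u v = E u v Bool.≟ true

-- `σ` is a bipartition known to exist; the program has no access to it, and it serves only as a
-- reference for the sides that are computed.
module Correct (n : ℕ) (E : ℕ → ℕ → Bool) (σ : ℕ → Bool)
               (E-sym : ∀ u v → E u v ≡ true → E v u ≡ true)
               (proper : ∀ u v → E u v ≡ true → σ u ≢ σ v) where
  open Semantics n E

  degree-correct : ∀ ρ h → exec (for countNeighbour) ρ (update deg 0 0 h) deg 0 ≡ count
    (adjacent? E (ρ 1)) n
  degree-correct ρ h = for-rule countNeighbour ρ (update deg 0 0 h)
    (λ j h′ → h′ deg 0 ≡ count (adjacent? E (ρ 1)) j) refl
    (λ j h′ j<n _ p → choose (adjacent? E (ρ 1) j)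
      (λ h″ → h″ deg 0 ≡ count (adjacent? E (ρ 1)) (suc j))
      (λ e → trans (cong (_+ 1) p) (sym (count-yes (adjacent? E (ρ 1)) e)))
      (λ ¬e → trans p (sym (count-no (adjacent? E (ρ 1)) ¬e))))

  module _ (ρ : Env) (h : Heap) (h≡0 : h maxDeg 0 ≡ 0) where
    private
      Inv : ℕ → Heap → Set
      Inv i h′ = (∀ u → u < i → count (adjacent? E u) n ≤ h′ maxDeg 0) ×
                 (∀ B → (∀ u → u < n → count (adjacent? E u) n ≤ B) → h′ maxDeg 0 ≤ B)

    maximumDegree-correct : Inv n (exec maximumDegree ρ h)
    maximumDegree-correct = for-rule degreeStep ρ h Inv
      ((λ _ ()) , (λ B _ → subst (_≤ B) (sym h≡0) z≤n)) step
      where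
      step : ∀ i h′ → i < n → Agree degreeStep h h′ → Inv i h′ →
             Inv (suc i) (exec degreeStep (ρ [ 1 ≔ i ]) h′)
      step i h′ i<n _ (upper , least) = choose (h″ maxDeg 0 ≤? h″ deg 0) (Inv (suc i))
        (λ le →
          (λ u u<1+i → [ (λ u<i → ≤-trans (upper u u<i) (subst (_≤ h″ deg 0) same-max le))
                       , (λ { refl → ≤-reflexive (sym deg≡) }) ]′ (m<1+n⇒m<n∨m≡n u<1+i)) ,
          (λ B all≤B → subst (_≤ B) (sym deg≡) (all≤B i i<n)))
        (λ ¬le →
          (λ u u<1+i → [ (λ u<i → subst (_ ≤_) (sym same-max) (upper u u<i))
                       , (λ { refl → ≤-trans (≤-reflexive (sym deg≡)) (<⇒≤ (≰⇒> ¬le)) }) ]′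
                         (m<1+n⇒m<n∨m≡n u<1+i)) ,
          (λ B all≤B → subst (_≤ B) (sym same-max) (least B all≤B)))
        where
        h″ = exec (for countNeighbour) (ρ [ 1 ≔ i ]) (update deg 0 0 h′)
        deg≡ : h″ deg 0 ≡ count (adjacent? E i) n
        deg≡ = degree-correct (ρ [ 1 ≔ i ]) h′
        same-max : h″ maxDeg 0 ≡ h′ maxDeg 0
        same-max = frame (for countNeighbour) {ρ [ 1 ≔ i ]} {update deg 0 0 h′} {maxDeg} refl 0

  -- Each component is sided relative to the vertex that names it, so its computed sides agree with
  -- `σ` up to a flip of the whole component. Adjacent vertices share the name and hence the flip.
  Partial : ℕ → Heap → Set
  Partial v h = (∀ w → w < v → h comp w < v) ×
                (∀ w → w < v → h side w ≡ bit (σ w xor σ (h comp w))) ×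
                (∀ u w → u < v → w < v → E u w ≡ true → h comp u ≡ h comp w)

  private
    -- The arithmetic of `relabel`, with a, c, v the values of `σ` at a vertex, at its old component
    -- name and at the current vertex: the reference point moves from c to v.
    flip : ∀ a c v → (if bit (a xor c) ≡ᵇ bit (not v xor c) then 1 else 0) ≡ bit (a xor v)
    flip = λ where
      false false false → refl
      false false true  → refl
      false true  false → refl
      false true  true  → refl
      true  false false → refl
      true  false true  → refl
      true  true  false → refl
      true  true  true  → refl

    xor-cong-not : ∀ a b c → (a ≢ b) → a xor c ≢ b xor c
    xor-cong-not false false c ne eq = ne refl
    xor-cong-not false true  false ne ()
    xor-cong-not false true  true  ne ()
    xor-cong-not true  false false ne ()
    xor-cong-not true  false true  ne ()
    xor-cong-not true  true  c ne eq = ne refl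

    pick : ℕ → ℕ → ℕ → ℕ
    pick zero    a b = a
    pick (suc _) a b = b

    pick-pos : ∀ {x} a b → x ≢ 0 → pick x a b ≡ b
    pick-pos {zero}  a b x≢0 = contradiction refl x≢0
    pick-pos {suc _} a b _   = refl

  module Step (ρ : Env) (v : ℕ) (v<n : v < n) (ρ1≡v : ρ 1 ≡ v) where

    -- Every neighbour u of v has `σ u` opposite to `σ v`, so the mark on a component c is
    -- determined by v and c alone.
    Hits : Heap → Set
    Hits h = ∀ c → c < n → h hit c ≡ 0 ⊎ h hit c ≡ suc (bit (not (σ v) xor σ c))

    resetHit-correct : ∀ h → ∀ c → c < n → exec (for resetHit) ρ h hit c ≡ 0
    resetHit-correct h = for-rule resetHit ρ h (λ j h′ → ∀ c → c < j → h′ hit c ≡ 0) (λ _ ())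
      (λ j h′ j<n _ p c c<1+j → [ (λ c<j → trans (update-other hit 0 h′ (<⇒≢ c<j)) (p c c<j))
                                 , (λ { refl → update-same hit c 0 h′ }) ]′ (m<1+n⇒m<n∨m≡n c<1+j))

    markHit-correct : ∀ h → Partial v h → (∀ c → c < n → h hit c ≡ 0) →
                      let h′ = exec (for markHit) ρ h in
                      Hits h′ × (∀ u → u < n → u < v → E u v ≡ true → h′ hit (h comp u) ≢ 0)
    markHit-correct h (comp< , sides , edges) hit≡0 = for-rule markHit ρ h
      (λ j h′ → Hits h′ × (∀ u → u < j → u < v → E u v ≡ true → h′ hit (h comp u) ≢ 0))
      ((λ c c<n → inj₁ (hit≡0 c c<n)) , (λ _ ()))
      step
      where
      step : ∀ j h′ → j < n → Agree markHit h h′ →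
             (Hits h′ × (∀ u → u < j → u < v → E u v ≡ true → h′ hit (h comp u) ≢ 0)) →
             let h″ = exec markHit (ρ [ 0 ≔ j ]) h′ in
             Hits h″ × (∀ u → u < suc j → u < v → E u v ≡ true → h″ hit (h comp u) ≢ 0)
      step j h′ j<n same (hits , marked) rewrite ρ1≡v =
        choose ((suc j ≤? v) ×-dec (E j v Bool.≟ true))
          (λ h″ → Hits h″ × (∀ u → u < suc j → u < v → E u v ≡ true → h″ hit (h comp u) ≢ 0))
          on off
        where
        z = 1 + h′ side j
        target = h′ comp j
        on : suc j ≤ v × E j v ≡ true → _
        on (j<v , e) = hits′ , marked′
          where
          value : z ≡ suc (bit (not (σ v) xor σ target))
          value = cong suc (trans (same side refl j) (trans (sides j j<v)
            (cong₂ (λ a c → bit (a xor σ c)) (Bool.¬-not (proper j v e)) (sym (same comp refl j)))))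
          hits′ : Hits (update hit target z h′)
          hits′ c c<n with c ≡ᵇ target | compare-≡ᵇ c target
          ... | true  | equal refl = inj₂ value
          ... | false | unequal _    = hits c c<n
          marked′ : ∀ u → u < suc j → u < v → E u v ≡ true →
            update hit target z h′ hit (h comp u) ≢ 0
          marked′ u u<1+j u<v e′ eq with h comp u ≡ᵇ target | compare-≡ᵇ (h comp u) target
          ... | true  | equal _ = contradiction eq (λ ())
          ... | false | unequal ne = [ (λ u<j → marked u u<j u<v e′ eq)
                                  , (λ { refl → ne (sym (same comp refl u)) }) ]′
                                    (m<1+n⇒m<n∨m≡n u<1+j)
        off : ¬ (suc j ≤ v × E j v ≡ true) → _
        off ¬c = hits , λ u u<1+j u<v e → [ (λ u<j → marked u u<j u<v e)
                                          , (λ { refl → contradiction (u<v , e) ¬c }) ]′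
                                            (m<1+n⇒m<n∨m≡n u<1+j)

    module Relabel (h : Heap) (partial : Partial v h) (hits : Hits h) where
      comp< = proj₁ partial
      sides = proj₁ (proj₂ partial)

      new : ℕ → ℕ
      new w = pick (h hit (h comp w)) (h comp w) v

      -- Updating in place is safe because each vertex reads only its own name and side and the
      -- unchanging marks: entries from j on are still old, those before j are final.
      Inv : ℕ → Heap → Set
      Inv j h′ = (∀ w → j ≤ w → h′ comp w ≡ h comp w × h′ side w ≡ h side w) ×
                 (∀ w → w < j → w < v → h′ comp w ≡ new w × h′ side w ≡ bit (σ w xor σ (new w)))

      relabel-correct : Inv n (exec (for relabel) ρ h)
      relabel-correct = for-rule relabel ρ h Inv ((λ _ _ → refl , refl) , (λ _ ())) step
        where
        step : ∀ j h′ → j < n → Agree relabel h h′ → Inv j h′ →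
               Inv (suc j) (exec relabel (ρ [ 0 ≔ j ]) h′)
        step j h′ j<n same (rest , done) rewrite ρ1≡v =
          choose ((suc j ≤? v) ×-dec (1 ≤? h′ hit (h′ comp j))) (Inv (suc j)) on off
          where
          comp≡ : h′ comp j ≡ h comp j
          comp≡ = proj₁ (rest j ≤-refl)
          hit≡ : h′ hit (h′ comp j) ≡ h hit (h comp j)
          hit≡ = trans (same hit refl (h′ comp j)) (cong (h hit) comp≡)
          change : ∀ z → z ≡ bit (σ j xor σ v) → new j ≡ v →
            Inv (suc j) (update comp j v (update side j z h′))
          change z z≡ new≡v =
            (λ w j<w → trans (update-other comp v (update side j z h′) (>⇒≢ j<w))
              (proj₁ (rest w (<⇒≤ j<w)))
                     , trans (update-other side z h′ (>⇒≢ j<w)) (proj₂ (rest w (<⇒≤ j<w)))) ,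
            (λ w w<1+j w<v → [ (λ w<j → trans (update-other comp v (update side j z h′) (<⇒≢ w<j))
              (proj₁ (done w w<j w<v))
                                      , trans (update-other side z h′ (<⇒≢ w<j))
                                        (proj₂ (done w w<j w<v)))
                             , (λ { refl → trans (update-same comp w v (update side w z h′))
                               (sym new≡v)
                                         , trans (update-same side w z h′)
                                           (trans z≡ (cong (λ c → bit (σ w xor σ c)) (sym new≡v)))
                                           })
                             ]′ (m<1+n⇒m<n∨m≡n w<1+j))
          on : suc j ≤ v × 1 ≤ h′ hit (h′ comp j) → _
          on (j<v , 1≤hit) =
            choose (1 + h′ side j ≟ h′ hit (h′ comp j)) (λ h″ → Inv (suc j) (update comp j v h″))
              (λ eq → change 1 (trans (yes-case eq) flip′) new≡v)
              (λ ne → change 0 (trans (no-case ne) flip′) new≡v)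
            where
            hit≢0 : h hit (h comp j) ≢ 0
            hit≢0 eq = <⇒≢ 1≤hit (sym (trans hit≡ eq))
            new≡v : new j ≡ v
            new≡v = pick-pos (h comp j) v hit≢0
            c = h comp j
            hit-value : h′ hit (h′ comp j) ≡ suc (bit (not (σ v) xor σ c))
            hit-value = trans hit≡ ([ (λ eq → contradiction eq hit≢0) , id ]′
              (hits c (<-trans (comp< j j<v) v<n)))
            side-value : h′ side j ≡ bit (σ j xor σ c)
            side-value = trans (proj₂ (rest j ≤-refl)) (sides j j<v)
            new-side = if bit (σ j xor σ c) ≡ᵇ bit (not (σ v) xor σ c) then 1 else 0
            flip′ : new-side ≡ bit (σ j xor σ v)
            flip′ = flip (σ j) (σ c) (σ v)
            if-true : ∀ {a b} → a ≡ b → 1 ≡ (if a ≡ᵇ b then 1 else 0)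
            if-true {a} {b} eq with a ≡ᵇ b | compare-≡ᵇ a b
            ... | true  | _      = refl
            ... | false | unequal ne = contradiction eq ne
            if-false : ∀ {a b} → a ≢ b → 0 ≡ (if a ≡ᵇ b then 1 else 0)
            if-false {a} {b} ne with a ≡ᵇ b | compare-≡ᵇ a b
            ... | true  | equal eq = contradiction eq ne
            ... | false | _       = refl
            yes-case : 1 + h′ side j ≡ h′ hit (h′ comp j) → 1 ≡ new-side
            yes-case eq = if-true (suc-injective
              (trans (cong suc (sym side-value)) (trans eq hit-value)))
            no-case : 1 + h′ side j ≢ h′ hit (h′ comp j) → 0 ≡ new-side
            no-case ne = if-false (λ eq → ne (trans (cong suc side-value)
              (trans (cong suc eq) (sym hit-value))))
          off : ¬ (suc j ≤ v × 1 ≤ h′ hit (h′ comp j)) → _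
          off ¬c = (λ w j<w → rest w (<⇒≤ j<w)) ,
            (λ w w<1+j w<v → [ (λ w<j → done w w<j w<v)
                             , (λ { refl → trans comp≡ (sym (new≡ w<v))
                                         , trans (proj₂ (rest w ≤-refl))
                                           (trans (sides w w<v) (cong (λ c → bit (σ w xor σ c))
                                           (sym (new≡ w<v)))) })
                             ]′ (m<1+n⇒m<n∨m≡n w<1+j))
            where
            new≡ : j < v → new j ≡ h comp j
            new≡ j<v with h hit (h comp j) in eq
            ... | zero  = refl
            ... | suc _ = contradiction (j<v , subst (1 ≤_) (sym (trans hit≡ eq)) (s≤s z≤n)) ¬c

    step-correct : ∀ h → Partial v h → Partial (suc v) (exec bipartitionStep ρ h)
    step-correct h partial = subst (λ z → Partial (suc v) (update side z 0 (update comp z z h₃)))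
      (sym ρ1≡v) (comp<′ , sides′ , edges′)
      where
      h₁ = exec (for resetHit) ρ h
      h₂ = exec (for markHit) ρ h₁
      h₃ = exec (for relabel) ρ h₂
      h₄ = update side v 0 (update comp v v h₃)
      comp₁ : ∀ w → h₁ comp w ≡ h comp w
      comp₁ = frame (for resetHit) {ρ} {h} {comp} refl
      side₁ : ∀ w → h₁ side w ≡ h side w
      side₁ = frame (for resetHit) {ρ} {h} {side} refl
      comp₂ : ∀ w → h₂ comp w ≡ h₁ comp w
      comp₂ = frame (for markHit) {ρ} {h₁} {comp} refl
      side₂ : ∀ w → h₂ side w ≡ h₁ side w
      side₂ = frame (for markHit) {ρ} {h₁} {side} refl
      transfer : ∀ {v h h′} → (∀ w → h′ comp w ≡ h comp w) → (∀ w → h′ side w ≡ h side w) →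
        Partial v h → Partial v h′
      transfer ceq seq (a , b , c) =
        (λ w w<v → subst (_< _) (sym (ceq w)) (a w w<v)) ,
        (λ w w<v → trans (seq w) (trans (b w w<v) (cong (λ c → bit (σ w xor σ c)) (sym (ceq w))))) ,
        (λ u w u<v w<v e → trans (ceq u) (trans (c u w u<v w<v e) (sym (ceq w))))
      partial₁ : Partial v h₁
      partial₁ = transfer {v} {h} {h₁} comp₁ side₁ partial
      partial₂ : Partial v h₂
      partial₂ = transfer {v} {h₁} {h₂} comp₂ side₂ partial₁
      marks = markHit-correct h₁ partial₁ (resetHit-correct h)
      open Relabel h₂ partial₂ (proj₁ marks)
      done : ∀ w → w < v → h₃ comp w ≡ new w × h₃ side w ≡ bit (σ w xor σ (new w))
      done w w<v = proj₂ relabel-correct w (<-trans w<v v<n) w<v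
      marked : ∀ u → u < v → E u v ≡ true → new u ≡ v
      marked u u<v e = pick-pos (h₂ comp u) v
        (λ eq → proj₂ marks u (<-trans u<v v<n) u<v e (trans (cong (h₂ hit) (sym (comp₂ u))) eq))
      comp-old : ∀ w → w < v → h₄ comp w ≡ new w
      comp-old w w<v = trans (update-other comp v h₃ (<⇒≢ w<v)) (proj₁ (done w w<v))
      comp-new : h₄ comp v ≡ v
      comp-new = update-same comp v v h₃
      new≤v : ∀ w → w < v → new w ≤ v
      new≤v w w<v with h₂ hit (h₂ comp w)
      ... | zero  = <⇒≤ (proj₁ partial₂ w w<v)
      ... | suc _ = ≤-refl
      comp<′ : ∀ w → w < suc v → h₄ comp w < suc v
      comp<′ w w<1+v = s≤s ([ (λ w<v → subst (_≤ v) (sym (comp-old w w<v)) (new≤v w w<v))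
                            , (λ { refl → ≤-reflexive comp-new }) ]′ (m<1+n⇒m<n∨m≡n w<1+v))
      xor-self : ∀ a → bit (a xor a) ≡ 0
      xor-self false = refl
      xor-self true  = refl
      sides′ : ∀ w → w < suc v → h₄ side w ≡ bit (σ w xor σ (h₄ comp w))
      sides′ w w<1+v = [ old , (λ { refl → trans (update-same side v 0 (update comp v v h₃))
                                     (sym (trans (cong (λ c → bit (σ v xor σ c)) comp-new)
                                       (xor-self (σ v)))) }) ]′ (m<1+n⇒m<n∨m≡n w<1+v)
        where
        old : w < v → _
        old w<v = trans (update-other side 0 (update comp v v h₃) (<⇒≢ w<v))
          (trans (proj₂ (done w w<v))
          (cong (λ c → bit (σ w xor σ c)) (sym (comp-old w w<v))))
      edges′ : ∀ u w → u < suc v → w < suc v → E u w ≡ true → h₄ comp u ≡ h₄ comp w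
      edges′ u w u<1+v w<1+v e with m<1+n⇒m<n∨m≡n u<1+v | m<1+n⇒m<n∨m≡n w<1+v
      ... | inj₁ u<v  | inj₁ w<v  = trans (comp-old u u<v) (trans
              (cong (λ c → pick (h₂ hit c) c v) (proj₂ (proj₂ partial₂) u w u<v w<v e))
                (sym (comp-old w w<v)))
      ... | inj₁ u<v  | inj₂ refl = trans (comp-old u u<v) (trans (marked u u<v e) (sym comp-new))
      ... | inj₂ refl | inj₁ w<v  = trans comp-new
        (sym (trans (comp-old w w<v) (marked w w<v (E-sym v w e))))
      ... | inj₂ refl | inj₂ refl = refl

  -- The witness `τ` is `σ` flipped per component; across an edge the names coincide, so the flips
  -- cancel and properness is inherited from `σ`.
  bipartition-correct : ∀ ρ h → let h′ = exec bipartition ρ h in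
    Σ[ τ ∈ (ℕ → Bool) ] ((∀ w → w < n → h′ side w ≡ bit (τ w)) ×
                         (∀ u w → u < n → w < n → E u w ≡ true → τ u ≢ τ w))
  bipartition-correct ρ h =
    (λ w → σ w xor σ (h′ comp w)) , proj₁ (proj₂ partial) ,
    (λ u w u<n w<n e eq → xor-cong-not (σ u) (σ w) (σ (h′ comp w)) (proper u w e)
      (trans (cong (λ c → σ u xor σ c) (sym (proj₂ (proj₂ partial) u w u<n w<n e))) eq))
    where
    h′ = exec bipartition ρ h
    partial : Partial n h′
    partial = for-rule bipartitionStep ρ h Partial ((λ _ ()) , (λ _ ()) , (λ _ _ ()))
      (λ v h″ v<n _ p → Step.step-correct (ρ [ 1 ≔ v ]) v v<n refl h″ p)

  module _ (ρ : Env) (h : Heap) (tally≡0 : ∀ b → h tally b ≡ 0) where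
    private
      h₁ = exec (for tallyStep) ρ h
      on : ∀ b → Decidable (λ v → h side v ≡ b)
      on b v = h side v ≟ b

      tallies : ∀ b → h₁ tally b ≡ count (on b) n
      tallies = for-rule tallyStep ρ h (λ i h′ → ∀ b → h′ tally b ≡ count (on b) i) tally≡0 step
        where
        step : ∀ i h′ → i < n → Agree tallyStep h h′ →
               (∀ b → h′ tally b ≡ count (on b) i) →
               ∀ b → exec tallyStep (ρ [ 1 ≔ i ]) h′ tally b ≡ count (on b) (suc i)
        step i h′ i<n same p b with b ≡ᵇ h′ side i | compare-≡ᵇ b (h′ side i)
        ... | true  | equal refl = trans (cong (_+ 1) (p b))
          (sym (count-yes (on b) (sym (same side refl i))))
        ... | false | unequal ne   = trans (p b)
          (sym (count-no (on b) (λ eq → ne (trans (sym eq) (sym (same side refl i))))))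

      both : h₁ tally 0 + h₁ tally 1 ≤ n
      both = subst (_≤ n) (sym (cong₂ _+_ (tallies 0) (tallies 1)))
        (≤-trans (count-disjoint (on 0) (on 1) (λ v → yes tt) n (λ _ _ _ → tt) (λ _ _ _ → tt)
                   (λ v _ p q → contradiction (trans (sym p) q) (λ ())))
                 (count-≤ (λ v → yes tt) n))

      double : ∀ a → 2 * a ≡ a + a
      double a = cong (λ z → a + z) (+-identityʳ a)

    smallerSide-flag : ∃[ b ] (exec smallerSide ρ h flag 0 ≡ bit b)
    smallerSide-flag = choose (h₁ tally 1 ≤? h₁ tally 0) (λ h′ → ∃[ b ] (h′ flag 0 ≡ bit b))
      (λ _ → true , refl) (λ _ → false , refl)

    smallerSide-correct : let h′ = exec smallerSide ρ h in
      h′ tally (h′ flag 0) ≡ count (λ v → h′ side v ≟ h′ flag 0) n × 2 * h′ tally (h′ flag 0) ≤ n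
    smallerSide-correct = choose (h₁ tally 1 ≤? h₁ tally 0)
      (λ h′ → h′ tally (h′ flag 0) ≡ count (λ v → h′ side v ≟ h′ flag 0) n × 2 * h′ tally
        (h′ flag 0) ≤ n)
      (λ le → trans (tallies 1) (same-count 1)
            , ≤-trans (≤-reflexive (double (h₁ tally 1))) (≤-trans (+-monoˡ-≤ _ le) both))
      (λ ¬le → trans (tallies 0) (same-count 0)
             , ≤-trans (≤-reflexive (double (h₁ tally 0)))
               (≤-trans (+-monoʳ-≤ _ (<⇒≤ (≰⇒> ¬le))) both))
      where
      same-side : ∀ v → h₁ side v ≡ h side v
      same-side = frame (for tallyStep) {ρ} {h} {side} refl
      same-count : ∀ b → count (on b) n ≡ count (λ v → h₁ side v ≟ b) n
      same-count b = count-cong (on b) (λ v → h₁ side v ≟ b) n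
        (λ v _ eq → trans (same-side v) eq) (λ v _ eq → trans (sym (same-side v)) eq)

-- The two first-fit phases as programs

start : Exp 0 → Exp 0
start e = e *′ size /′ ![ classes ]

-- Since `start e` evaluates to `S e`, `hasRoom` compares the count with `cap` without truncated
-- subtraction, and `roomSmall` compares it with `quota`.
hasRoom isPure roomSmall roomLarge : Cond 0
hasRoom   = cnt at inner +′ start inner <′ start (num 1 +′ inner)
isPure    = start (num 1 +′ inner) ≤′ tally at ![ flag ]
roomSmall = (isPure and hasRoom) or (neg isPure and cnt at inner <′ ![ share ])
roomLarge = bad at inner ≡′ num 0 and hasRoom

-- A loop always makes n rounds, so the rounds from k on are disabled explicitly, and a class once
-- found is protected by the first test.
firstFitStep : Cond 0 → Cmd 0
firstFitStep room =
  when size ≤′ ![ best ] and inner <′ ![ classes ] and room then ![ best ]≔ inner else skip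

-- The value n of best means that no class has been found.
firstFit : Cond 0 → Cmd 1
firstFit room =
  ![ best ]≔ size ⨾
  for (firstFitStep room) ⨾
  color at outer ≔ ![ best ] ⨾
  cnt at ![ best ] ≔ cnt at ![ best ] +′ num 1

smallStep : Cmd 1
smallStep = when side at outer ≡′ ![ flag ] then firstFit roomSmall else skip

-- Only run for vertices of the larger side: all their neighbours lie on the smaller side and are
-- already colored, so the default color 0 of uncolored vertices is never mistaken for a real one.
resetBad markBad : Cmd 0
resetBad = bad at inner ≔ num 0
markBad  = when edge 0 1 then bad at (color at inner) ≔ num 1 else skip

largeStep : Cmd 1
largeStep = when side at outer ≡′ ![ flag ]
            then skip
            else (for resetBad ⨾ for markBad ⨾ firstFit roomLarge)

-- Correctness of the first-fit phases

count-assign : ∀ (X? : Decidable P) (f f′ : ℕ → ℕ) i b →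
               P i → f′ i ≡ b → (∀ v → v < i → f′ v ≡ f v) → ∀ j →
               count (λ v → X? v ×-dec (f′ v ≟ j)) (suc i) ≡
               count (λ v → X? v ×-dec (f v ≟ j)) i + bit (j ≡ᵇ b)
count-assign X? f f′ i b x f′i old j = last
  where
  new? = λ v → X? v ×-dec (f′ v ≟ j)
  old? = λ v → X? v ×-dec (f v ≟ j)
  before : count new? i ≡ count old? i
  before = count-cong new? old? i (λ v v<i (p , q) → p , trans (sym (old v v<i)) q)
                                  (λ v v<i (p , q) → p , trans (old v v<i) q)
  last : count new? (suc i) ≡ count old? i + bit (j ≡ᵇ b)
  last with j ≡ᵇ b | compare-≡ᵇ j b
  ... | true  | equal refl = trans (count-yes new? (x , f′i)) (cong (_+ 1) before)
  ... | false | unequal ne = trans (count-no new? (λ (_ , q) → ne (trans (sym q) f′i)))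
          (trans before (sym (+-identityʳ _)))

sum-cong : ∀ (f g : ℕ → ℕ) k → (∀ j → f j ≡ g j) → sum f k ≡ sum g k
sum-cong f g k eq = ≤-antisym (sum-mono f g k (λ j _ → ≤-reflexive (eq j)))
  (sum-mono g f k (λ j _ → ≤-reflexive (sym (eq j))))

module Place (n : ℕ) (E : ℕ → ℕ → Bool) (E-sym : ∀ u v → E u v ≡ true → E v u ≡ true)
             (k D m : ℕ) (200≤D : 200 ≤ D) (20D≤n : 20 * D ≤ n)
             (D+2≤2k : D + 2 ≤ 2 * k) (2k≤D+3 : 2 * k ≤ D + 3) (2m≤n : 2 * m ≤ n)
             (degree≤D : ∀ u → u < n → count (adjacent? E u) n ≤ D) where
  open Semantics n E
  open Classes n k D m renaming (share to shareSize)
  open Bounds 200≤D 20D≤n D+2≤2k 2k≤D+3 2m≤n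

  k≤n : k ≤ n
  k≤n = ≤-trans (m≤m+n k _) 8k≤n

  cap-below : ∀ {x} j → x < cap j → x + S j < S (suc j)
  cap-below j lt = ≰⇒> λ le → <⇒≱ lt (not-below-cap j (≤⇒≯ le))

  cnt-assign : ∀ b z i (h : Heap) j →
               update cnt b (h cnt b + 1) (update color i z h) cnt j ≡ h cnt j + bit (j ≡ᵇ b)
  cnt-assign b z i h j with j ≡ᵇ b | compare-≡ᵇ j b
  ... | true  | equal refl = refl
  ... | false | _          = sym (+-identityʳ _)

  -- The search common to both phases. `Fits` is the meaning of the room test, fixed before the
  -- loop; the test has to express it in every heap that differs from h only in `best`, the one
  -- array written by the search.
  module Search (room : Cond 0) (ρ : Env) (h : Heap) (h-classes : h classes 0 ≡ k) (Fits : ℕ → Set)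
                (sound : ∀ h′ → Agree (firstFitStep room) h h′ →
                         ∀ j → Holds room (ρ [ 0 ≔ j ]) h′ → Fits j)
                (complete : ∀ h′ → Agree (firstFitStep room) h h′ →
                            ∀ j → Fits j → Holds room (ρ [ 0 ≔ j ]) h′)
                (exists : ∃[ j ] (j < k × Fits j)) where

    private
      body : Cmd 0
      body = firstFitStep room

      Inv : ℕ → Heap → Set
      Inv i h′ = (h′ best 0 ≡ n × (∀ j → j < i → j < k → ¬ Fits j)) ⊎
                 (h′ best 0 < k × Fits (h′ best 0) × (∀ j → j < h′ best 0 → ¬ Fits j))

    h₁ h₂ : Heap
    h₁ = update best 0 n h
    h₂ = exec (for body) ρ h₁

    private
      step : ∀ i h′ → i < n → Agree (firstFitStep room) h₁ h′ → Inv i h′ →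
             Inv (suc i) (exec body (ρ [ 0 ≔ i ]) h′)
      step i h′ i<n unchanged inv =
        choose ((n ≤? h′ best 0) ×-dec ((suc i ≤? h′ classes 0) ×-dec holds? room (ρ [ 0 ≔ i ]) h′))
          (Inv (suc i)) fitting unfitting
        where
        best-written : ∀ x → writes body x ≡ false → ∀ j → h₁ x j ≡ h x j
        best-written x eq j with x Fin.≟ best
        ... | no _  = refl
        unchanged′ : Agree (firstFitStep room) h h′
        unchanged′ x eq j = trans (unchanged x eq j) (best-written x eq j)
        classes≡ : h′ classes 0 ≡ k
        classes≡ = trans (unchanged classes refl 0) h-classes
        fitting : n ≤ h′ best 0 × (i < h′ classes 0 × Holds room (ρ [ 0 ≔ i ]) h′) →
                  Inv (suc i) (update best 0 i h′)
        fitting (n≤best , i<k , holds) =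
          [ (λ (_ , none) → inj₂ (i<k′ , sound h′ unchanged′ i holds ,
                                  λ j j<i → none j j<i (<-trans j<i i<k′)))
          , (λ (best<k , _) → contradiction n≤best (<⇒≱ (<-≤-trans best<k k≤n))) ]′ inv
          where i<k′ = subst (i <_) classes≡ i<k
        unfitting : ¬ (n ≤ h′ best 0 × (i < h′ classes 0 × Holds room (ρ [ 0 ≔ i ]) h′)) →
                    Inv (suc i) h′
        unfitting ¬c = [ (λ (best≡n , none) → inj₁ (best≡n , still-none best≡n none)) , inj₂ ]′ inv
          where
          still-none : h′ best 0 ≡ n → (∀ j → j < i → j < k → ¬ Fits j) →
                       ∀ j → j < suc i → j < k → ¬ Fits j
          still-none best≡n none j j<1+i j<k r =
            [ (λ j<i → none j j<i j<k r)
            , (λ { refl → ¬c (≤-reflexive (sym best≡n) , subst (i <_) (sym classes≡) j<k ,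
                              complete h′ unchanged′ i r) }) ]′ (m<1+n⇒m<n∨m≡n j<1+i)

    found : h₂ best 0 < k × Fits (h₂ best 0) × (∀ j → j < h₂ best 0 → ¬ Fits j)
    found = [ (λ (_ , none) → let j , j<k , r = exists
                              in contradiction r (none j (<-≤-trans j<k k≤n) j<k)) , id ]′
            (for-rule body ρ h₁ Inv (inj₁ (refl , λ _ ())) step)

  -- Used twice, with the heap at the start of each phase as `h₀`, so that the smaller side is
  -- described by data that the phase does not change.
  module Fixed (h₀ : Heap) (classes₀ : h₀ classes 0 ≡ k) (share₀ : h₀ share 0 ≡ shareSize)
               (tally₀ : h₀ tally (h₀ flag 0) ≡ m) where
    Small : ℕ → Set
    Small v = h₀ side v ≡ h₀ flag 0

    small? : Decidable Small
    small? v = h₀ side v ≟ h₀ flag 0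

    large? : Decidable (λ v → ¬ Small v)
    large? v = ¬? (small? v)

    module SmallPhase (small-count : count small? n ≡ m) (cnt₀ : ∀ j → h₀ cnt j ≡ 0) where

      -- The last two parts are the hypotheses of `FirstFit`, which then yields room for the next
      -- vertex. Adjacency does not enter because the vertices of one side are independent.
      Inv : ℕ → Heap → Set
      Inv i h = (∀ j → h cnt j ≡ count (λ v → small? v ×-dec (h color v ≟ j)) i) ×
                (∀ v → v < i → Small v → h color v < k) ×
                (∀ j → j < k → h cnt j ≤ quota j) ×
                (∀ i′ j → i′ < j → j < k → 0 < h cnt j → quota i′ ≤ h cnt i′)

      sum-cnt : ∀ i h → Inv i h → sum (h cnt) k ≡ count small? i
      sum-cnt i h (counts , colors , _) = trans (sum-cong (h cnt) _ k counts)
        (trans (sum-count small? (h color) i k)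
        (count-cong (λ v → small? v ×-dec (h color v <? k)) small? i (λ _ _ → proj₁)
          (λ v v<i p → p , colors v v<i p)))

      module _ (ρ : Env) where
        step : ∀ i h → i < n → Agree smallStep h₀ h → Inv i h →
               Inv (suc i) (exec smallStep (ρ [ 1 ≔ i ]) h)
        step i h i<n unchanged inv@(counts , colors , c≤quota , first-fit) =
          choose (h side i ≟ h flag 0) (Inv (suc i)) on off
          where
          off : ¬ (h side i ≡ h flag 0) → Inv (suc i) h
          off ¬M = (λ j → trans (counts j) (sym
            (count-no (λ v → small? v ×-dec (h color v ≟ j)) (¬small ∘ proj₁)))) ,
                   (λ v v<1+i p → [ (λ v<i → colors v v<i p) ,
                     (λ { refl → contradiction p ¬small }) ]′ (m<1+n⇒m<n∨m≡n v<1+i)) ,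
                   c≤quota , first-fit
            where
            ¬small : ¬ Small i
            ¬small p = ¬M (trans (unchanged side refl i) (trans p (sym (unchanged flag refl 0))))
          on : h side i ≡ h flag 0 → _
          on isM = counts′ , colors′ , c≤quota′ , first-fit′
            where
            small-i : Small i
            small-i = trans (sym (unchanged side refl i)) (trans isM (unchanged flag refl 0))
            Fits : ℕ → Set
            Fits j = h cnt j < quota j
            -- The evaluated room test with the heap contents as parameters, so that heap equalities
            -- can be applied to it by `transport`.
            RoomFor : ℕ → ℕ → ℕ → ℕ → ℕ → Set
            RoomFor j k′ m′ x g =
              (quot (suc j * n) k′ ≤ m′ × suc (x + quot (j * n) k′) ≤ quot (suc j * n) k′) ⊎
              (¬ (quot (suc j * n) k′ ≤ m′) × suc x ≤ g)
            transport : ∀ j {a a′ b b′ c c′ d d′} → a ≡ a′ → b ≡ b′ → c ≡ c′ → d ≡ d′ →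
              RoomFor j a b c d → RoomFor j a′ b′ c′ d′
            transport j refl refl refl refl r = r
            to : ∀ j → RoomFor j k m (h cnt j) shareSize → Fits j
            to j (inj₁ (pure , below)) = subst (h cnt j <_) (sym (quota-pure j pure))
              (below-cap j below)
            to j (inj₂ (mixed , below)) = subst (h cnt j <_) (sym (quota-mixed j mixed)) below
            from : ∀ j → Fits j → RoomFor j k m (h cnt j) shareSize
            from j r = by-cases (S (suc j) ≤? m)
              where
              by-cases : Dec (S (suc j) ≤ m) → RoomFor j k m (h cnt j) shareSize
              by-cases (yes pure)  = inj₁ (pure , cap-below j
                (subst (h cnt j <_) (quota-pure j pure) r))
              by-cases (no mixed)  = inj₂ (mixed , subst (h cnt j <_) (quota-mixed j mixed) r)
            module _ (h′ : Heap) (same : Agree (firstFitStep roomSmall) h h′) where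
              eq-classes : h′ classes 0 ≡ k
              eq-classes = trans (same classes refl 0) (trans (unchanged classes refl 0) classes₀)
              eq-tally : h′ tally (h′ flag 0) ≡ m
              eq-tally = trans (same tally refl (h′ flag 0))
                (trans (unchanged tally refl (h′ flag 0))
                (trans (cong (h₀ tally) (trans (same flag refl 0) (unchanged flag refl 0))) tally₀))
              eq-share : h′ share 0 ≡ shareSize
              eq-share = trans (same share refl 0) (trans (unchanged share refl 0) share₀)
              sound : ∀ j → Holds roomSmall ((ρ [ 1 ≔ i ]) [ 0 ≔ j ]) h′ → Fits j
              sound j r = to j (transport j eq-classes eq-tally (same cnt refl j) eq-share r)
              complete : ∀ j → Fits j → Holds roomSmall ((ρ [ 1 ≔ i ]) [ 0 ≔ j ]) h′
              complete j r = transport j (sym eq-classes) (sym eq-tally) (sym (same cnt refl j))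
                (sym eq-share) (from j r)
            open FirstFit (h cnt) c≤quota first-fit
            exists : ∃[ j ] (j < k × Fits j)
            exists = room (≤-trans (≤-reflexive (sum-cnt i h inv))
              (≤-trans (count-monoʳ small? (<⇒≤ i<n)) (≤-reflexive small-count)))
            open Search roomSmall (ρ [ 1 ≔ i ]) h (trans (unchanged classes refl 0) classes₀) Fits
              sound complete exists
            b = h₂ best 0
            h₃ = update cnt b (h₂ cnt b + 1) (update color i b h₂)
            b<k = proj₁ found
            room-b = proj₁ (proj₂ found)
            full-before : ∀ j → j < b → quota j ≤ h cnt j
            full-before j j<b = ≮⇒≥ (proj₂ (proj₂ found) j j<b)
            cnt₂ : ∀ j → h₂ cnt j ≡ h cnt j
            cnt₂ = frame (for (firstFitStep roomSmall)) {ρ [ 1 ≔ i ]} {update best 0 n h} {cnt} refl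
            color₂ : ∀ v → h₂ color v ≡ h color v
            color₂ = frame (for (firstFitStep roomSmall)) {ρ [ 1 ≔ i ]} {update best 0 n h}
              {color} refl
            color-old : ∀ v → v < i → h₃ color v ≡ h color v
            color-old v v<i = trans (update-other color b h₂ (<⇒≢ v<i)) (color₂ v)
            color-new : h₃ color i ≡ b
            color-new = update-same color i b h₂
            cnt₃ : ∀ j → h₃ cnt j ≡ h cnt j + bit (j ≡ᵇ b)
            cnt₃ j = trans (cnt-assign b b i h₂ j) (cong (_+ bit (j ≡ᵇ b)) (cnt₂ j))
            grow : ∀ j → h cnt j ≤ h₃ cnt j
            grow j = subst (h cnt j ≤_) (sym (cnt₃ j)) (m≤m+n _ _)
            counts′ : ∀ j → h₃ cnt j ≡ count (λ v → small? v ×-dec (h₃ color v ≟ j)) (suc i)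
            counts′ j = trans (cnt₃ j) (trans (cong (_+ bit (j ≡ᵇ b)) (counts j))
              (sym (count-assign small? (h color) (h₃ color) i b small-i color-new color-old j)))
            colors′ : ∀ v → v < suc i → Small v → h₃ color v < k
            colors′ v v<1+i p = [ (λ v<i → subst (_< k) (sym (color-old v v<i)) (colors v v<i p))
                                , (λ { refl → subst (_< k) (sym color-new) b<k }) ]′
                                  (m<1+n⇒m<n∨m≡n v<1+i)
            c≤quota′ : ∀ j → j < k → h₃ cnt j ≤ quota j
            c≤quota′ j j<k = subst (_≤ quota j) (sym (cnt₃ j)) bound
              where
              bound : h cnt j + bit (j ≡ᵇ b) ≤ quota j
              bound with j ≡ᵇ b | compare-≡ᵇ j b
              ... | true  | equal refl = subst (_≤ quota j) (+-comm 1 (h cnt j)) room-b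
              ... | false | _          = subst (_≤ quota j) (sym (+-identityʳ _)) (c≤quota j j<k)
            first-fit′ : ∀ i′ j → i′ < j → j < k → 0 < h₃ cnt j → quota i′ ≤ h₃ cnt i′
            first-fit′ i′ j i′<j j<k 0<c = ≤-trans (before (subst (0 <_) (cnt₃ j) 0<c)) (grow i′)
              where
              before : 0 < h cnt j + bit (j ≡ᵇ b) → quota i′ ≤ h cnt i′
              before 0<c with j ≡ᵇ b | compare-≡ᵇ j b
              -- Class j may have become nonempty just now; then it is the first class that fitted,
              -- so all earlier ones had met their quota.
              ... | true  | equal refl = full-before i′ i′<j
              ... | false | _          = first-fit i′ j i′<j j<k (subst (0 <_) (+-identityʳ _) 0<c)

        smallPhase : Inv n (exec (for smallStep) ρ h₀)
        smallPhase = for-rule smallStep ρ h₀ Inv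
          (cnt₀ , (λ _ ()) , (λ j _ → subst (_≤ quota j) (sym (cnt₀ j)) z≤n)
                , (λ i′ j _ _ 0<c → contradiction (sym (cnt₀ j)) (<⇒≢ 0<c)))
          step

    module LargePhase (small-count : count small? n ≡ m)
                      (bipartite : ∀ u v → u < n → v < n → E u v ≡ true → ¬ Small v → Small u)
                      (independent : ∀ u v → u < n → v < n → E u v ≡ true → Small v → ¬ Small u)
                      (counts₀ : ∀ j → h₀ cnt j ≡ count (λ v → small? v ×-dec (h₀ color v ≟ j)) n)
                      (colors₀ : ∀ v → v < n → Small v → h₀ color v < k)
                      (c≤quota : ∀ j → j < k → h₀ cnt j ≤ quota j)
                      (first-fit : ∀ i j → i < j → j < k → 0 < h₀ cnt j → quota i ≤ h₀ cnt i) where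

      private
        c : ℕ → ℕ
        c = h₀ cnt

        open FirstFit c c≤quota first-fit using (not-stuck)

        sum-c : sum c k ≡ m
        sum-c = trans (sum-cong c (λ j → count (λ v → small? v ×-dec (h₀ color v ≟ j)) n) k
          counts₀) (trans (sum-count small? (h₀ color) n k)
          (trans (count-cong (λ v → small? v ×-dec (h₀ color v <? k)) small? n (λ _ _ → proj₁)
            (λ v v<n p → p , colors₀ v v<n p)) small-count))

      -- Stated through the colors in `h₀`, which stay frozen on the smaller side; a refusal
      -- therefore remains valid for the whole phase.
      Refused : ℕ → ℕ → Set
      Refused v j = ∃[ u ] (u < n × (Small u × h₀ color u ≡ j) × E u v ≡ true)

      -- The field `full` is the memory of first fit: each class passed over by v was full or
      -- refused v. It persists because counts only grow and refusals are permanent.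
      record Inv (i : ℕ) (h : Heap) : Set where
        field
          old       : ∀ v → Small v → h color v ≡ h₀ color v
          counts    : ∀ j → h cnt j ≡ c j + count (λ v → large? v ×-dec (h color v ≟ j)) i
          colors    : ∀ v → v < i → ¬ Small v → h color v < k
          c≤cap     : ∀ j → j < k → h cnt j ≤ cap j
          full      : ∀ v → v < i → ¬ Small v → ∀ j → j < h color v → cap j ≤ h cnt j ⊎ Refused v j
          separated : ∀ v → v < i → ¬ Small v → ∀ u → u < n → E u v ≡ true → h color u ≢ h color v

      module _ (ρ : Env) where
        module Step (i : ℕ) (h : Heap) (i<n : i < n) (large-i : ¬ Small i)
                    (unchanged : ∀ x → writes largeStep x ≡ false → ∀ j → h x j ≡ h₀ x j)
                      (inv : Inv i h) where
          open Inv inv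

          ρ′ : Env
          ρ′ = ρ [ 1 ≔ i ]

          l : ℕ → ℕ
          l j = count (λ v → large? v ×-dec (h color v ≟ j)) i

          sum-l : ∀ q → sum l q ≡ count (λ v → large? v ×-dec (h color v <? q)) i
          sum-l = sum-count large? (h color) i

          h₁ h₂ : Heap
          h₁ = exec (for resetBad) ρ′ h
          h₂ = exec (for markBad) ρ′ h₁

          color₁ : ∀ v → h₁ color v ≡ h color v
          color₁ = frame (for resetBad) {ρ′} {h} {color} refl

          Bad : ℕ → ℕ → Set
          Bad b j = ∃[ u ] (u < b × E u i ≡ true × h color u ≡ j)

          bad-zero : ∀ j → j < n → h₁ bad j ≡ 0
          bad-zero = for-rule resetBad ρ′ h (λ b h′ → ∀ j → j < b → h′ bad j ≡ 0) (λ _ ())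
            (λ b h′ _ _ p j j<1+b → [ (λ j<b → trans (update-other bad 0 h′ (<⇒≢ j<b)) (p j j<b))
                                    , (λ { refl → update-same bad j 0 h′ }) ]′
                                      (m<1+n⇒m<n∨m≡n j<1+b))

          bad-correct : ∀ j → j < n → (h₂ bad j ≡ 0 × ¬ Bad n j) ⊎ (h₂ bad j ≢ 0 × Bad n j)
          bad-correct = for-rule markBad ρ′ h₁ Marked
            (λ j j<n → inj₁ (bad-zero j j<n , λ { (_ , () , _) })) step
            where
            Marked : ℕ → Heap → Set
            Marked b h′ = ∀ j → j < n → (h′ bad j ≡ 0 × ¬ Bad b j) ⊎ (h′ bad j ≢ 0 × Bad b j)
            step : ∀ b h′ → b < n → Agree markBad h₁ h′ → Marked b h′ →
                   Marked (suc b) (exec markBad (ρ′ [ 0 ≔ b ]) h′)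
            step b h′ b<n same p = choose (E b i Bool.≟ true) (Marked (suc b)) on off
              where
              color′ : h′ color b ≡ h color b
              color′ = trans (same color refl b) (color₁ b)
              later : ∀ {j} → Bad b j → Bad (suc b) j
              later (u , u<b , rest) = u , m<n⇒m<1+n u<b , rest
              on : E b i ≡ true → Marked (suc b) (update bad (h′ color b) 1 h′)
              on e j j<n with j ≡ᵇ h′ color b | compare-≡ᵇ j (h′ color b)
              ... | true  | equal refl = inj₂ ((λ ()) , b , ≤-refl , e , sym color′)
              ... | false | unequal ne = [ (λ (z , none) → inj₁ (z , λ (u , u<1+b , e′ , eq) →
                                              [ (λ u<b → none (u , u<b , e′ , eq)) ,
                                                (λ { refl → ne (trans (sym eq) (sym color′)) }) ]′
                                                (m<1+n⇒m<n∨m≡n u<1+b)))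
                                         , (λ (nz , w) → inj₂ (nz , later w)) ]′ (p j j<n)
              off : ¬ (E b i ≡ true) → Marked (suc b) h′
              off ¬e j j<n = [ (λ (z , none) → inj₁ (z , λ (u , u<1+b , e′ , eq) →
                                  [ (λ u<b → none (u , u<b , e′ , eq)) , (λ { refl → ¬e e′ }) ]′
                                    (m<1+n⇒m<n∨m≡n u<1+b)))
                             , (λ (nz , w) → inj₂ (nz , later w)) ]′ (p j j<n)

          same₂ : ∀ x → writes resetBad x ≡ false → writes markBad x ≡ false → ∀ j → h₂ x j ≡ h x j
          same₂ x eq₁ eq₂ j = trans (frame (for markBad) {ρ′} {h₁} {x} eq₂ j)
            (frame (for resetBad) {ρ′} {h} {x} eq₁ j)

          Fits : ℕ → Set
          Fits j = h₂ bad j ≡ 0 × h₂ cnt j < cap j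

          Fits? : Decidable Fits
          Fits? j = (h₂ bad j ≟ 0) ×-dec (h₂ cnt j <? cap j)

          refused : ∀ {j} → Bad n j → Refused i j
          refused (u , u<n , e , eq) = u , u<n , (small-u , trans (sym (old u small-u)) eq) , e
            where small-u = bipartite u i u<n i<n e large-i

          cnt₂ : ∀ j → h₂ cnt j ≡ h cnt j
          cnt₂ = same₂ cnt refl refl

          misfit : ∀ j → j < k → ¬ Fits j → cap j ≤ h cnt j ⊎ Refused i j
          misfit j j<k ¬r =
            [ (λ (z , _) → inj₁ (subst (cap j ≤_) (cnt₂ j) (≮⇒≥ λ lt → ¬r (z , lt))))
            , (λ (_ , w) → inj₂ (refused w)) ]′ (bad-correct j (<-≤-trans j<k k≤n))

          large-total : m + count large? n ≤ n
          large-total = subst (λ z → z + count large? n ≤ n) small-count (≤-trans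
            (count-disjoint small? large? (λ v → v ≟ v) n (λ _ _ _ → refl) (λ _ _ _ → refl)
              (λ v _ p ¬p → ¬p p))
            (count-≤ (λ v → v ≟ v) n))

          -- The current vertex i belongs to the larger side and is not yet counted.
          total<n : sum (λ j → c j + l j) k < n
          total<n = begin-strict
            sum (λ j → c j + l j) k     ≡⟨ sum-+ c l k ⟩
            sum c k + sum l k           ≡⟨ cong₂ _+_ sum-c (sum-l k) ⟩
            m + count (λ v → large? v ×-dec (h color v <? k)) i
              ≤⟨ +-monoʳ-≤ m (count-mono (λ v → large? v ×-dec (h color v <? k)) large? i
              (λ _ _ → proj₁)) ⟩
            m + count large? i          <⟨ +-monoʳ-< m (count-< large? i<n large-i) ⟩
            m + count large? n          ≤⟨ large-total ⟩
            n                           ∎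
            where open ≤-Reasoning

          -- A class that is not full now never was. So every larger-side vertex placed beyond it
          -- was refused by it, and is adjacent to one of its `c j` smaller-side vertices, each of
          -- degree at most D.
          few : ∀ j → ¬ (cap j ≤ h cnt j) → sum l k ≤ sum l (suc j) + c j * D
          few j ¬full = begin
            sum l k                              ≡⟨ sum-l k ⟩
            count below-k? i                     ≤⟨ count-⊎ upto? beyond? below-k? i split ⟩
            count upto? i + count beyond? i      ≤⟨
              +-mono-≤ (≤-reflexive (sym (sum-l (suc j)))) (begin
              count beyond? i                      ≤⟨
                count-mono beyond? beyond′? i (λ v v<i p → v<i , p) ⟩
              count beyond′? i                     ≤⟨ count-monoʳ beyond′? (<⇒≤ i<n) ⟩
              count beyond′? n                     ≤⟨
                union-bound (adjacent? E) in-class? beyond′? n D n degree≤D cover ⟩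
              count in-class? n * D                ∎) ⟩
            sum l (suc j) + count in-class? n * D  ≡⟨
              cong (λ z → sum l (suc j) + z * D) (sym (counts₀ j)) ⟩
            sum l (suc j) + c j * D              ∎
            where
            in-class? : Decidable (λ u → Small u × h₀ color u ≡ j)
            in-class? u = small? u ×-dec (h₀ color u ≟ j)
            open ≤-Reasoning
            below-k? : Decidable (λ v → ¬ Small v × h color v < k)
            below-k? v = large? v ×-dec (h color v <? k)
            upto? : Decidable (λ v → ¬ Small v × h color v < suc j)
            upto? v = large? v ×-dec (h color v <? suc j)
            beyond? : Decidable (λ v → ¬ Small v × j < h color v)
            beyond? v = large? v ×-dec (j <? h color v)
            beyond′? : Decidable (λ v → v < i × ¬ Small v × j < h color v)
            beyond′? v = (v <? i) ×-dec beyond? v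
            split : ∀ v → v < i → ¬ Small v × h color v < k →
                    (¬ Small v × h color v < suc j) ⊎ (¬ Small v × j < h color v)
            split v _ (p , _) = [ (λ le → inj₁ (p , s≤s le)) , (λ lt → inj₂ (p , lt)) ]′
              (≤-<-connex (h color v) j)
            cover : ∀ v → v < n → v < i × ¬ Small v × j < h color v → Refused v j
            cover v _ (v<i , p , j<) = [ (λ le → contradiction le ¬full) , id ]′ (full v v<i p j j<)

          exists : ∃[ j ] (j < k × Fits j)
          exists = search (anyUpTo? Fits? k)
            where
            blocked : (∀ j → j < k → ¬ Fits j) → ∀ j → j < k →
              cap j ≤ c j + l j ⊎ (0 < c j × sum l k ≤ sum l (suc j) + c j * D)
            blocked none j j<k = by-cases (cap j ≤? h cnt j)
              where
              nonempty : Refused i j → 0 < c j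
              nonempty (u , u<n , p , _) = subst (0 <_) (sym (counts₀ j))
                (≤-<-trans z≤n (count-< (λ v → small? v ×-dec (h₀ color v ≟ j)) u<n p))
              by-cases : Dec (cap j ≤ h cnt j) → _
              by-cases (yes full′) = inj₁ (subst (cap j ≤_) (counts j) full′)
              by-cases (no ¬full)  = [ (λ full′ → contradiction full′ ¬full) ,
                (λ r → inj₂ (nonempty r , few j ¬full)) ]′ (misfit j j<k (none j j<k))
            search : Dec (∃[ j ] (j < k × Fits j)) → ∃[ j ] (j < k × Fits j)
            search (yes found) = found
            search (no none)   = ⊥-elim (not-stuck sum-c l total<n
              (blocked (λ j j<k r → none (j , j<k , r))))

          classes₂ : h₂ classes 0 ≡ k
          classes₂ = trans (same₂ classes refl refl 0) (trans (unchanged classes refl 0) classes₀)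

          RoomFor : ℕ → ℕ → ℕ → ℕ → Set
          RoomFor j k′ b x = b ≡ 0 × suc (x + quot (j * n) k′) ≤ quot (suc j * n) k′

          transport : ∀ j {a a′ b b′ c c′} → a ≡ a′ → b ≡ b′ → c ≡ c′ →
                      RoomFor j a b c → RoomFor j a′ b′ c′
          transport j refl refl refl r = r

          module _ (h′ : Heap) (same : Agree (firstFitStep roomLarge) h₂ h′) where
            sound : ∀ j → Holds roomLarge (ρ′ [ 0 ≔ j ]) h′ → Fits j
            sound j r =
              let z , lt = transport j (trans (same classes refl 0) classes₂) (same bad refl j)
                             (same cnt refl j) r
              in z , below-cap j lt
            complete : ∀ j → Fits j → Holds roomLarge (ρ′ [ 0 ≔ j ]) h′
            complete j (z , lt) = transport j (sym (trans (same classes refl 0) classes₂))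
              (sym (same bad refl j)) (sym (same cnt refl j))
                                    (z , cap-below j lt)

          open Search roomLarge ρ′ h₂ classes₂ Fits sound complete exists public
            using (found) renaming (h₂ to h₃)

          b : ℕ
          b = h₃ best 0

          h₄ : Heap
          h₄ = update cnt b (h₃ cnt b + 1) (update color i b h₃)

          same₃ : Agree (firstFitStep roomLarge) (update best 0 n h₂) h₃
          same₃ x eq = frame (for (firstFitStep roomLarge)) {ρ′} {update best 0 n h₂} {x} eq

          cnt₃ : ∀ j → h₃ cnt j ≡ h cnt j
          cnt₃ j = trans (same₃ cnt refl j) (cnt₂ j)

          color₃ : ∀ v → h₃ color v ≡ h color v
          color₃ v = trans (same₃ color refl v) (same₂ color refl refl v)

          b<k : b < k
          b<k = proj₁ found

          room-b : h cnt b < cap b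
          room-b = subst (_< cap b) (cnt₂ b) (proj₂ (proj₁ (proj₂ found)))

          good-b : ¬ Bad n b
          good-b = [ proj₂ , (λ (nz , _) → contradiction (proj₁ (proj₁ (proj₂ found))) nz) ]′
            (bad-correct b (<-≤-trans b<k k≤n))

          cnt₄ : ∀ j → h₄ cnt j ≡ h cnt j + bit (j ≡ᵇ b)
          cnt₄ j = trans (cnt-assign b b i h₃ j) (cong (_+ bit (j ≡ᵇ b)) (cnt₃ j))

          grow : ∀ j → h cnt j ≤ h₄ cnt j
          grow j = subst (h cnt j ≤_) (sym (cnt₄ j)) (m≤m+n _ _)

          color-other : ∀ v → v ≢ i → h₄ color v ≡ h color v
          color-other v v≢i = trans (update-other color b h₃ v≢i) (color₃ v)

          color-new : h₄ color i ≡ b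
          color-new = update-same color i b h₃

          color-small : ∀ v → Small v → h₄ color v ≡ h color v
          color-small v p = color-other v (λ { refl → large-i p })

          color-old : ∀ v → v < i → h₄ color v ≡ h color v
          color-old v v<i = color-other v (<⇒≢ v<i)

          inv′ : Inv (suc i) h₄
          inv′ .Inv.old v p = trans (color-small v p) (old v p)
          inv′ .Inv.counts j = trans (cnt₄ j)
            (trans (cong (_+ bit (j ≡ᵇ b)) (counts j)) (trans (+-assoc (c j) _ _)
            (cong (λ z → c j + z) (sym (count-assign large? (h color) (h₄ color) i b large-i
              color-new color-old j)))))
          inv′ .Inv.colors v v<1+i p = [ (λ v<i → subst (_< k) (sym (color-old v v<i))
            (colors v v<i p))
                                       , (λ { refl → subst (_< k) (sym color-new) b<k }) ]′
                                         (m<1+n⇒m<n∨m≡n v<1+i)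
          inv′ .Inv.c≤cap j j<k = subst (_≤ cap j) (sym (cnt₄ j)) bound
            where
            bound : h cnt j + bit (j ≡ᵇ b) ≤ cap j
            bound with j ≡ᵇ b | compare-≡ᵇ j b
            ... | true  | equal refl = subst (_≤ cap j) (+-comm 1 (h cnt j)) room-b
            ... | false | _          = subst (_≤ cap j) (sym (+-identityʳ _)) (c≤cap j j<k)
          inv′ .Inv.full v v<1+i p j j<color = [ earlier , latest ]′ (m<1+n⇒m<n∨m≡n v<1+i)
            where
            widen : cap j ≤ h cnt j ⊎ Refused v j → cap j ≤ h₄ cnt j ⊎ Refused v j
            widen = [ (λ le → inj₁ (≤-trans le (grow j))) , inj₂ ]′
            earlier : v < i → cap j ≤ h₄ cnt j ⊎ Refused v j
            earlier v<i = widen (full v v<i p j (subst (j <_) (color-old v v<i) j<color))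
            latest : v ≡ i → cap j ≤ h₄ cnt j ⊎ Refused v j
            latest v≡i = widen (subst (λ z → cap j ≤ h cnt j ⊎ Refused z j) (sym v≡i)
              (misfit j (<-trans j<b b<k) (proj₂ (proj₂ found) j j<b)))
              where j<b = subst (j <_) (trans (cong (h₄ color) v≡i) color-new) j<color
          inv′ .Inv.separated v v<1+i p u u<n e eq = [ earlier , latest ]′ (m<1+n⇒m<n∨m≡n v<1+i)
            where
            small-u : v < n → Small u
            small-u v<n = bipartite u v u<n v<n e p
            earlier : ¬ (v < i)
            earlier v<i = separated v v<i p u u<n e
              (trans (sym (color-small u (small-u (<-trans v<i i<n)))) (trans eq (color-old v v<i)))
            latest : ¬ (v ≡ i)
            latest refl = good-b (u , u<n , e , trans (sym (color-small u (small-u i<n)))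
              (trans eq color-new))

        step : ∀ i h → i < n → Agree largeStep h₀ h → Inv i h →
               Inv (suc i) (exec largeStep (ρ [ 1 ≔ i ]) h)
        step i h i<n unchanged inv = choose (h side i ≟ h flag 0) (Inv (suc i)) skipped
          (λ ¬M → Step.inv′ i h i<n (λ p → ¬M
            (trans (unchanged side refl i) (trans p (sym (unchanged flag refl 0))))) unchanged inv)
          where
          open Inv inv
          skipped : h side i ≡ h flag 0 → Inv (suc i) h
          skipped isM = record
            { old       = old
            ; counts    = λ j → trans (counts j)
              (cong (λ z → c j + z) (sym (count-no (λ v → large? v ×-dec (h color v ≟ j))
              (λ (¬p , _) → ¬p small-i))))
            ; colors    = λ v v<1+i p → [ (λ v<i → colors v v<i p) ,
              (λ { refl → contradiction small-i p }) ]′ (m<1+n⇒m<n∨m≡n v<1+i)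
            ; c≤cap     = c≤cap
            ; full      = λ v v<1+i p → [ (λ v<i → full v v<i p) ,
              (λ { refl → contradiction small-i p }) ]′ (m<1+n⇒m<n∨m≡n v<1+i)
            ; separated = λ v v<1+i p → [ (λ v<i → separated v v<i p) ,
              (λ { refl → contradiction small-i p }) ]′ (m<1+n⇒m<n∨m≡n v<1+i)
            }
            where
            small-i : Small i
            small-i = trans (sym (unchanged side refl i)) (trans isM (unchanged flag refl 0))

        initially : Inv 0 h₀
        initially = record
          { old       = λ _ _ → refl
          ; counts    = λ j → sym (+-identityʳ _)
          ; colors    = λ _ ()
          ; c≤cap     = λ j j<k → ≤-trans (c≤quota j j<k) (quota≤cap j)
          ; full      = λ _ ()
          ; separated = λ _ ()
          }

        h∞ : Heap
        h∞ = exec (for largeStep) ρ h₀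

        open Inv (for-rule largeStep ρ h₀ Inv initially step)

        all-colored : ∀ v → v < n → h∞ color v < k
        all-colored v v<n = by-cases (small? v)
          where
          by-cases : Dec (Small v) → h∞ color v < k
          by-cases (yes p) = subst (_< k) (sym (old v p)) (colors₀ v v<n p)
          by-cases (no ¬p) = colors v v<n ¬p

        all-separated : ∀ u v → u < n → v < n → E u v ≡ true → h∞ color u ≢ h∞ color v
        all-separated u v u<n v<n e eq = by-cases (small? v)
          where
          by-cases : Dec (Small v) → ⊥
          by-cases (yes p) = separated u u<n (independent u v u<n v<n e p) v v<n (E-sym u v e)
            (sym eq)
          by-cases (no ¬p) = separated v v<n ¬p u u<n e eq

        private
          of-color? : ∀ j → Decidable (λ v → h∞ color v ≡ j)
          of-color? j v = h∞ color v ≟ j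

          in-small? : ∀ j → Decidable (λ v → Small v × h₀ color v ≡ j)
          in-small? j v = small? v ×-dec (h₀ color v ≟ j)

          in-large? : ∀ j → Decidable (λ v → ¬ Small v × h∞ color v ≡ j)
          in-large? j v = large? v ×-dec (h∞ color v ≟ j)

          class-size : ∀ j → count (of-color? j) n ≡ h∞ cnt j
          class-size j = trans (≤-antisym
            (count-⊎ (in-small? j) (in-large? j) (of-color? j) n
              (λ v _ eq → by-cases v eq (small? v)))
            (count-disjoint (in-small? j) (in-large? j) (of-color? j) n
              (λ v _ (p , eq) → trans (old v p) eq) (λ v _ → proj₂)
                (λ v _ (p , _) (¬p , _) → ¬p p)))
            (sym (trans (counts j) (cong (_+ count (in-large? j) n) (counts₀ j))))
            where
            by-cases : ∀ v → h∞ color v ≡ j → Dec (Small v) →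
              (Small v × h₀ color v ≡ j) ⊎ (¬ Small v × h∞ color v ≡ j)
            by-cases v eq (yes p) = inj₁ (p , trans (sym (old v p)) eq)
            by-cases v eq (no ¬p) = inj₂ (¬p , eq)

          total : sum (h∞ cnt) k ≡ n
          total = begin
            sum (h∞ cnt) k                                        ≡⟨
              sum-cong (h∞ cnt) _ k (sym ∘ class-size) ⟩
            sum (λ j → count (of-color? j) n)
              k                   ≡⟨ sum-cong _ _ k
              (λ j → count-cong (of-color? j) (λ v → any? v ×-dec of-color? j v) n
              (λ v _ eq → refl , eq) (λ v _ → proj₂)) ⟩
            sum (λ j → count (λ v → any? v ×-dec of-color? j v) n) k
              ≡⟨ sum-count any? (h∞ color) n k ⟩
            count (λ v → any? v ×-dec (h∞ color v <? k))
              n        ≡⟨ count-all (λ v → any? v ×-dec (h∞ color v <? k)) n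
              (λ v v<n → refl , all-colored v v<n) ⟩
            n                                                     ∎
            where
            open ≡-Reasoning
            any? : Decidable (λ v → v ≡ v)
            any? v = v ≟ v

        -- Capacities add up to n and none is exceeded, so the n placed vertices fill each class to
        -- its capacity, and capacities differ by at most one.
        balanced : ∀ a b → a < k → b < k → count (of-color? a) n ≤ suc (count (of-color? b) n)
        balanced a b a<k b<k = begin
          count (of-color? a) n        ≡⟨ class-size a ⟩
          h∞ cnt a                     ≤⟨ c≤cap a a<k ⟩
          cap a                        ≤⟨ cap≤1+classMin a ⟩
          suc classMin                 ≤⟨ s≤s (classMin≤cap b) ⟩
          suc (cap b)                  ≤⟨ s≤s
            (sum-tight (h∞ cnt) cap k c≤cap (≤-reflexive
            (trans (sum-cap k) (trans S-k (sym total)))) b b<k) ⟩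
          suc (h∞ cnt b)               ≡⟨ cong suc (sym (class-size b)) ⟩
          suc (count (of-color? b) n)  ∎
          where open ≤-Reasoning

-- The complete algorithm

setup : Cmd 2
setup =
  -- Adding 1 before halving turns the floor into the ceiling ⌈Δ/2⌉.
  ![ classes ]≔ (![ maxDeg ] +′ num 1) /′ num 2 +′ num 1 ⨾
  ![ share ]≔ size /′ ![ classes ] /′ num 8

equitableColoring : Cmd 2
equitableColoring =
  maximumDegree ⨾ bipartition ⨾ smallerSide ⨾ setup ⨾ for smallStep ⨾ for largeStep

-- Input graphs

-- Padding by `false` leaves no edge outside the graph, so symmetry and properness hold for all
-- natural numbers without range conditions.
extend : ∀ {n} → (Fin n → Bool) → ℕ → Bool
extend {zero}  f v       = false
extend {suc n} f zero    = f zero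
extend {suc n} f (suc v) = extend (f ∘ suc) v

extend-toℕ : ∀ {n} (f : Fin n → Bool) i → extend f (toℕ i) ≡ f i
extend-toℕ f zero    = refl
extend-toℕ f (suc i) = extend-toℕ (f ∘ suc) i

extend-true : ∀ {n} (f : Fin n → Bool) v → extend f v ≡ true → ∃[ i ] (toℕ i ≡ v × f i ≡ true)
extend-true {suc n} f zero    eq = zero , refl , eq
extend-true {suc n} f (suc v) eq =
  let i , i≡v , fi = extend-true (f ∘ suc) v eq 
  in suc i , cong suc i≡v , fi

-- `count` peels off the last index whereas `tabulate` peels off the first; this reconciles the two.
count-shift : ∀ (P? : Decidable P) n → count P? (suc n) ≡ bit (does (P? 0)) + count (P? ∘ suc) n
count-shift P? zero    = sym (+-identityʳ _)
count-shift P? (suc n) = trans (cong (_+ bit (does (P? (suc n)))) (count-shift P? n))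
  (+-assoc (bit (does (P? 0))) _ _)

size-tabulate : ∀ {n} (f : Fin n → Bool) (P? : Decidable P) → (∀ i → f i ≡ does (P? (toℕ i))) →
                ∣ tabulate f ∣ ≡ count P? n
size-tabulate {n = zero}  f P? eq = refl
size-tabulate {n = suc n} f P? eq = trans (peel (f zero) (tabulate (f ∘ suc))) (trans
  (cong₂ _+_ (cong bit (eq zero)) (size-tabulate (f ∘ suc) (P? ∘ suc) (eq ∘ suc)))
    (sym (count-shift P? n)))
  where
  peel : ∀ {n} b (xs : Subset n) → ∣ b ∷ xs ∣ ≡ bit b + ∣ xs ∣
  peel false xs = refl
  peel true  xs = refl

half : ∀ m → quot m 2 ≡ ⌊ m /2⌋
half m = ≤-antisym (s≤s⁻¹ (quot-< (s≤s z≤n) (upper m))) (≤-quot (s≤s z≤n) (lower m))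
  where
  lower : ∀ m → ⌊ m /2⌋ * 2 ≤ m
  lower zero          = z≤n
  lower (suc zero)    = z≤n
  lower (suc (suc m)) = s≤s (s≤s (lower m))
  upper : ∀ m → m < suc ⌊ m /2⌋ * 2
  upper zero          = s≤s z≤n
  upper (suc zero)    = s≤s (s≤s z≤n)
  upper (suc (suc m)) = s≤s (s≤s (upper m))

module Input {n} (G : Graph n) (0<n : 0 < n) where

  E : ℕ → ℕ → Bool
  E u v = extend (λ i → extend (adj G i) v) u

  E-toℕ : ∀ i j → E (toℕ i) (toℕ j) ≡ adj G i j
  E-toℕ i j = trans (extend-toℕ (λ i → extend (adj G i) (toℕ j)) i) (extend-toℕ (adj G i) j)

  E-true : ∀ u v → E u v ≡ true → ∃[ i ] ∃[ j ] (toℕ i ≡ u × toℕ j ≡ v × adj G i j ≡ true)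
  E-true u v eq =
    let i , i≡u , eq′ = extend-true (λ i → extend (adj G i) v) u eq
        j , j≡v , eq″ = extend-true (adj G i) v eq′
    in i , j , i≡u , j≡v , eq″

  open Simulation n E

  input-cell : ∀ a (a<n² : a < n * n) →
               inputMemory G (+ a) ≡ (if uncurry (adj G) (remQuot n (fromℕ< a<n²)) then + 1
                 else + 0)
  input-cell a a<n² with a <? n * n
  ... | yes _   = refl
  ... | no a≮n² = contradiction a<n² a≮n²

  input-matrix : ∀ u v → u < n → v < n → inputMemory G (+ (n * u + v)) ≡ + bit (E u v)
  input-matrix u v u<n v<n = trans (input-cell (n * u + v) a<n²)
    (trans (cong (λ p → if uncurry (adj G) p then + 1 else + 0)
      (trans (cong (remQuot n) index≡) (Fin.remQuot-combine i j)))
      (trans (cong (λ b → if b then + 1 else + 0) (sym (E-toℕ i j)))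
        (trans (cong₂ (λ u v → if E u v then + 1 else + 0) (Fin.toℕ-fromℕ< u<n)
          (Fin.toℕ-fromℕ< v<n)) (if-bit (E u v)))))
    where
    i = fromℕ< u<n
    j = fromℕ< v<n
    toℕ-index : toℕ (combine i j) ≡ n * u + v
    toℕ-index = trans (Fin.toℕ-combine i j) (cong₂ (λ u v → n * u + v) (Fin.toℕ-fromℕ< u<n)
      (Fin.toℕ-fromℕ< v<n))
    a<n² : n * u + v < n * n
    a<n² = subst (_< n * n) toℕ-index (Fin.toℕ<n (combine i j))
    index≡ : fromℕ< a<n² ≡ combine i j
    index≡ = Fin.toℕ-injective (trans (Fin.toℕ-fromℕ< a<n²) (sym toℕ-index))
    if-bit : ∀ b → (if b then + 1 else + 0) ≡ + bit b
    if-bit false = refl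
    if-bit true  = refl

  input-zero : ∀ x w → inputMemory G (location n x w) ≡ + 0
  input-zero zero w with n * n + w <? n * n
  ... | yes lt = contradiction (m≤m+n (n * n) w) (<⇒≱ lt)
  ... | no _   = refl
  input-zero (suc x) w rewrite +-suc (16 * w) (toℕ x) = refl

  input-represents : Represents 2 (input G) (λ _ → 0) (λ _ _ → 0)
  input-represents = record
    { size-reg = refl
    -- All counters start at 0, and counter values are required to be below n; this is where n > 0
    -- enters.
    ; counters = λ e _ → refl , 0<n
    ; cells    = input-zero
    ; matrix   = input-matrix
    }

  degree-count : ∀ i → degree G i ≡ count (adjacent? E (toℕ i)) n
  degree-count i = size-tabulate (adj G i) (adjacent? E (toℕ i))
    (λ j → trans (sym (E-toℕ i j)) (does-true (E (toℕ i) (toℕ j))))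
    where
    does-true : ∀ b → b ≡ does (b Bool.≟ true)
    does-true false = refl
    does-true true  = refl

  degree≤Δ : ∀ u → u < n → count (adjacent? E u) n ≤ Δ G
  degree≤Δ u u<n = subst (_≤ Δ G) (trans (degree-count i)
    (cong (λ u → count (adjacent? E u) n) (Fin.toℕ-fromℕ< u<n)))
    (All.lookup (xs≤max 0 (List.map (degree G) (List.allFin n)))
      (List.∈-map⁺ (degree G) (List.∈-allFin i)))
    where i = fromℕ< u<n

  Δ-least : ∀ B → (∀ u → u < n → count (adjacent? E u) n ≤ B) → Δ G ≤ B
  Δ-least B bound = max≤v⁺ {xs = List.map (degree G) (List.allFin n)} z≤n
    (All.map⁺ (All.tabulate (λ {i} _ → subst (_≤ B) (sym (degree-count i))
      (bound (toℕ i) (Fin.toℕ<n i)))))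

  module Algorithm (bip : Bipartite G) (200≤Δ : 200 ≤ Δ G) (20Δ≤n : 20 * Δ G ≤ n) where

    private
      fin2 : Fin 2 → Bool
      fin2 zero       = false
      fin2 (suc zero) = true

      fin2-injective : ∀ a b → fin2 a ≡ fin2 b → a ≡ b
      fin2-injective zero       zero       _ = refl
      fin2-injective zero       (suc zero) ()
      fin2-injective (suc zero) zero       ()
      fin2-injective (suc zero) (suc zero) _ = refl

      σ : ℕ → Bool
      σ = extend (fin2 ∘ proj₁ bip)

      E-sym : ∀ u v → E u v ≡ true → E v u ≡ true
      E-sym u v eq with E-true u v eq
      ... | i , j , refl , refl , eq′ = trans (E-toℕ j i) (trans (adj-sym G j i) eq′)

      proper : ∀ u v → E u v ≡ true → σ u ≢ σ v
      proper u v eq σ≡ with E-true u v eq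
      ... | i , j , refl , refl , eq′ = proj₂ bip i j eq′ (fin2-injective _ _
              (trans (sym (extend-toℕ (fin2 ∘ proj₁ bip) i))
                (trans σ≡ (extend-toℕ (fin2 ∘ proj₁ bip) j))))

    k : ℕ
    k = ⌈ Δ G /2⌉ + 1

    open Semantics n E
    open Correct n E σ E-sym proper

    private
      ρ : Env
      ρ _ = 0

      h₁ h₂ h₃ h₄ h₅ : Heap
      h₁ = exec maximumDegree ρ (λ _ _ → 0)
      h₂ = exec bipartition ρ h₁
      h₃ = exec smallerSide ρ h₂
      h₄ = exec setup ρ h₃
      h₅ = exec (for smallStep) ρ h₄

      maxDeg₁ : h₁ maxDeg 0 ≡ Δ G
      maxDeg₁ = let upper , least = maximumDegree-correct ρ (λ _ _ → 0) refl
                in ≤-antisym (least (Δ G) degree≤Δ) (Δ-least (h₁ maxDeg 0) upper)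

      maxDeg₃ : h₃ maxDeg 0 ≡ Δ G
      maxDeg₃ = trans (frame smallerSide {ρ} {h₂} {maxDeg} refl 0)
        (trans (frame bipartition {ρ} {h₁} {maxDeg} refl 0) maxDeg₁)

      classes₄ : h₄ classes 0 ≡ k
      classes₄ = cong (_+ 1) (trans (cong (λ d → quot (d + 1) 2) maxDeg₃)
        (trans (cong (λ z → quot z 2) (+-comm (Δ G) 1)) (half (suc (Δ G)))))

      2k≤Δ+3 : 2 * k ≤ Δ G + 3
      2k≤Δ+3 = begin
        2 * (⌈ Δ G /2⌉ + 1)           ≡⟨ expand ⌈ Δ G /2⌉ ⟩
        ⌈ Δ G /2⌉ * 2 + 2             ≤⟨ +-monoˡ-≤
          2 (subst (λ q → q * 2 ≤ suc (Δ G)) (half (suc (Δ G)))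
          (quot-lower (suc (Δ G)) {2} (s≤s z≤n))) ⟩
        suc (Δ G) + 2                 ≡⟨ sym (+-suc (Δ G) 2) ⟩
        Δ G + 3                       ∎
        where
        open ≤-Reasoning
        expand : ∀ a → 2 * (a + 1) ≡ a * 2 + 2
        expand = solve-∀

      Δ+2≤2k : Δ G + 2 ≤ 2 * k
      Δ+2≤2k = begin
        Δ G + 2                       ≡⟨ +-comm (Δ G) 2 ⟩
        suc (suc (Δ G))               ≤⟨ subst (λ q → suc (Δ G) < suc q * 2) (half (suc (Δ G)))
          (quot-upper (suc (Δ G)) {2} (s≤s z≤n)) ⟩
        suc ⌈ Δ G /2⌉ * 2             ≡⟨ expand ⌈ Δ G /2⌉ ⟩
        2 * k                         ∎
        where
        open ≤-Reasoning
        expand : ∀ a → suc a * 2 ≡ 2 * (a + 1)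
        expand = solve-∀

      m : ℕ
      m = h₃ tally (h₃ flag 0)

      tally₂ : ∀ b → h₂ tally b ≡ 0
      tally₂ b = trans (frame bipartition {ρ} {h₁} {tally} refl b)
        (frame maximumDegree {ρ} {λ _ _ → 0} {tally} refl b)

      smaller = smallerSide-correct ρ h₂ tally₂

      open Place n E E-sym k (Δ G) m 200≤Δ 20Δ≤n Δ+2≤2k 2k≤Δ+3 (proj₂ smaller) degree≤Δ

      open Fixed h₄ classes₄ (cong (λ c → quot (quot n c) 8) classes₄) refl
        using (module SmallPhase) renaming (small? to small₄?)

      cnt₄ : ∀ j → h₄ cnt j ≡ 0
      cnt₄ j = trans (frame smallerSide {ρ} {h₂} {cnt} refl j)
        (trans (frame bipartition {ρ} {h₁} {cnt} refl j)
                 (frame maximumDegree {ρ} {λ _ _ → 0} {cnt} refl j))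

      smallPhase₅ = SmallPhase.smallPhase (sym (proj₁ smaller)) cnt₄ ρ

      same₅ : ∀ x → writes smallStep x ≡ false → ∀ j → h₅ x j ≡ h₄ x j
      same₅ x eq = frame (for smallStep) {ρ} {h₄} {x} eq

      classes₅ : h₅ classes 0 ≡ k
      classes₅ = trans (same₅ classes refl 0) classes₄

      share₅ : h₅ share 0 ≡ h₄ share 0
      share₅ = same₅ share refl 0

      tally₅ : h₅ tally (h₅ flag 0) ≡ m
      tally₅ = trans (same₅ tally refl (h₅ flag 0)) (cong (h₄ tally) (same₅ flag refl 0))

      open Fixed h₅ classes₅ (trans share₅ (cong (λ c → quot (quot n c) 8) classes₄)) tally₅
        using (Small; small?; module LargePhase)

      to₄ : ∀ v → Small v → h₄ side v ≡ h₄ flag 0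
      to₄ v p = trans (sym (same₅ side refl v)) (trans p (same₅ flag refl 0))

      from₄ : ∀ v → h₄ side v ≡ h₄ flag 0 → Small v
      from₄ v p = trans (same₅ side refl v) (trans p (sym (same₅ flag refl 0)))

      small-count₅ : count small? n ≡ m
      small-count₅ = trans (count-cong small? small₄? n (λ v _ → to₄ v) (λ v _ → from₄ v))
        (sym (proj₁ smaller))

      sides = bipartition-correct ρ h₁
      τ = proj₁ sides

      β = proj₁ (smallerSide-flag ρ h₂ tally₂)

      side₅ : ∀ v → v < n → h₅ side v ≡ bit (τ v)
      side₅ v v<n = trans (same₅ side refl v)
        (trans (frame smallerSide {ρ} {h₂} {side} refl v) (proj₁ (proj₂ sides) v v<n))

      flag₅ : h₅ flag 0 ≡ bit β
      flag₅ = trans (same₅ flag refl 0) (proj₂ (smallerSide-flag ρ h₂ tally₂))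

      bit-injective : ∀ {a b} → bit a ≡ bit b → a ≡ b
      bit-injective {false} {false} _ = refl
      bit-injective {true}  {true}  _ = refl

      bipartite₅ : ∀ u v → u < n → v < n → E u v ≡ true → ¬ Small v → Small u
      bipartite₅ u v u<n v<n e ¬p = trans (side₅ u u<n)
        (trans (cong bit (third (proj₂ (proj₂ sides) u v u<n v<n e)
        (λ eq → ¬p (trans (side₅ v v<n) (trans (cong bit eq) (sym flag₅)))))) (sym flag₅))
        where
        third : ∀ {a b c} → a ≢ b → b ≢ c → a ≡ c
        third {a} {b} {c} a≢b b≢c = trans (Bool.¬-not a≢b) (sym (Bool.¬-not (b≢c ∘ sym)))

      independent₅ : ∀ u v → u < n → v < n → E u v ≡ true → Small v → ¬ Small u
      independent₅ u v u<n v<n e p q = proj₂ (proj₂ sides) u v u<n v<n e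
        (bit-injective (trans (sym (side₅ u u<n)) (trans q (trans (sym p) (side₅ v v<n)))))

      counts₅ : ∀ j → h₅ cnt j ≡ count (λ v → small? v ×-dec (h₅ color v ≟ j)) n
      counts₅ j = trans (proj₁ smallPhase₅ j)
        (count-cong (λ v → small₄? v ×-dec (h₅ color v ≟ j))
        (λ v → small? v ×-dec (h₅ color v ≟ j)) n
        (λ v _ (p , q) → from₄ v p , q) (λ v _ (p , q) → to₄ v p , q))

      open LargePhase small-count₅ bipartite₅ independent₅ counts₅
        (λ v v<n p → proj₁ (proj₂ smallPhase₅) v v<n (to₄ v p))
        (proj₁ (proj₂ (proj₂ smallPhase₅))) (proj₂ (proj₂ (proj₂ smallPhase₅)))

    final : Heap
    final = exec equitableColoring ρ (λ _ _ → 0)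

    coloring : Fin n → Fin k
    coloring v = fromℕ< (all-colored ρ (toℕ v) (Fin.toℕ<n v))

    toℕ-coloring : ∀ v → toℕ (coloring v) ≡ final color (toℕ v)
    toℕ-coloring v = Fin.toℕ-fromℕ< (all-colored ρ (toℕ v) (Fin.toℕ<n v))

    equitable : EquitableColoring k G coloring
    equitable = proper′ , balanced′
      where
      proper′ : Proper G coloring
      proper′ u v e eq = all-separated ρ (toℕ u) (toℕ v) (Fin.toℕ<n u) (Fin.toℕ<n v)
        (trans (E-toℕ u v) e)
        (trans (sym (toℕ-coloring u)) (trans (cong toℕ eq) (toℕ-coloring v)))
      class : ∀ a → classSize coloring a ≡ count (λ v → final color v ≟ toℕ a) n
      class a = size-tabulate _ (λ v → final color v ≟ toℕ a) (λ v → does-⇔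
        (mk⇔ (λ eq → trans (sym (toℕ-coloring v)) (cong toℕ eq))
          (λ eq → Fin.toℕ-injective (trans (toℕ-coloring v) eq)))
        (coloring v Fin.≟ a) (final color (toℕ v) ≟ toℕ a))
      balanced′ : ∀ a b → classSize coloring a ≤ suc (classSize coloring b)
      balanced′ a b = subst₂ (λ x y → x ≤ suc y) (sym (class a)) (sym (class b))
        (balanced ρ (toℕ a) (toℕ b) (Fin.toℕ<n a) (Fin.toℕ<n b))

    result : Σ[ t ∈ ℕ ] Σ[ s ∈ State ]
               (Run (compile equitableColoring) (input G) t s ×
                 t ≤ (stepFactor equitableColoring * 4) * n ^ 2 ×
                (Σ[ f ∈ (Fin n → Fin k) ] (EquitableColoring k G f × Outputs s f)))
    result =
      let t , s , run , t≤ , R = simulates equitableColoring input-represents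
      in t , s , run , ≤-trans t≤ quadratic , coloring , equitable ,
         (λ v → trans (Represents.cells R color (toℕ v)) (cong +_ (sym (toℕ-coloring v))))
      where
      K = stepFactor equitableColoring
      -- For n > 0, n + 1 ≤ 2n; squaring gives the factor 4.
      quadratic : K * suc n ^ 2 ≤ (K * 4) * n ^ 2
      quadratic = begin
        K * suc n ^ 2         ≤⟨ *-monoʳ-≤ K (^-monoˡ-≤
          2 (subst (suc n ≤_) (cong (λ z → n + z) (sym (+-identityʳ n))) (+-monoˡ-≤ n 0<n))) ⟩
        K * (2 * n) ^ 2       ≡⟨ expand K n ⟩
        (K * 4) * n ^ 2       ∎
        where
        open ≤-Reasoning
        expand : ∀ K n → K * ((2 * n) * ((2 * n) * 1)) ≡ (K * 4) * (n * (n * 1))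
        expand = solve-∀

corollary3p1 : (ζ : ℝ) → (+ 41 / 2) <ᵣ ζ →
    Σ[ c ∈ ℕ ] (0 < c ×
    (Σ[ p ∈ Program ] Σ[ C ∈ ℕ ]
    (∀ (n : ℕ) (G : Graph n) → Bipartite G → c ≤ Δ G → ζ · Δ G ≤ᵣ n →
    Σ[ t ∈ ℕ ] Σ[ s ∈ State ]
    (Run p (input G) t s × t ≤ C * n ^ 2 ×
    (Σ[ f ∈ (Fin n → Fin (⌈ Δ G /2⌉ + 1)) ]
    (EquitableColoring (⌈ Δ G /2⌉ + 1) G f × Outputs s f))))))
corollary3p1 ζ 41/2<ζ =
  -- The threshold 200 is the one that makes `D<8d` absorb its additive constant; program and time
  -- constant are the same for every ζ.
  200 , s≤s z≤n , compile equitableColoring , stepFactor equitableColoring * 4 ,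
  λ n G bip 200≤Δ ζΔ≤n →
    -- The real inequality is evaluated at the rational 41/2, which lies in the lower cut of ζ.
    let 20Δ≤n = 20·≤ (Δ G) n (ζΔ≤n _ 41/2<ζ)
        0<n   = ≤-trans (≤-trans (s≤s z≤n) 200≤Δ) (≤-trans (m≤m+n (Δ G) _) 20Δ≤n)
    in Input.Algorithm.result G 0<n bip 200≤Δ 20Δ≤n
  where
  -- Clearing denominators gives 41d ≤ 2n, hence 40d ≤ 2n. The passage through unnormalised
  -- rationals makes numerators and denominators explicit.
  20·≤ : ∀ d n → (+ 41 / 2) ℚ.* (+ d / 1) ℚ.≤ + n / 1 → 20 * d ≤ n
  20·≤ d n le = *-cancelˡ-≤ 2 (begin
    2 * (20 * d)    ≡⟨ sym (*-assoc 2 20 d) ⟩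
    40 * d          ≤⟨ *-monoˡ-≤ d (m≤m+n 40 1) ⟩
    41 * d          ≡⟨ sym (*-identityʳ (41 * d)) ⟩
    41 * d * 1      ≤⟨ integers leᵘ ⟩
    n * 2           ≡⟨ *-comm n 2 ⟩
    2 * n           ∎)
    where
    open ≤-Reasoning
    fraction : ∀ d → ℚ.toℚᵘ (+ d / 1) ℚᵘ.≃ ℚᵘ.mkℚᵘ (+ d) 0
    fraction d = ℚ.toℚᵘ-fromℚᵘ (ℚᵘ.mkℚᵘ (+ d) 0)
    leᵘ : ℚᵘ.mkℚᵘ (+ 41) 1 ℚᵘ.* ℚᵘ.mkℚᵘ (+ d) 0 ℚᵘ.≤ ℚᵘ.mkℚᵘ (+ n) 0
    leᵘ = ℚᵘ.≤-respˡ-≃ (ℚᵘ.≃-trans (ℚ.toℚᵘ-homo-* (+ 41 / 2) (+ d / 1))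
                                   (ℚᵘ.*-congˡ {ℚᵘ.mkℚᵘ (+ 41) 1} (fraction d)))
            (ℚᵘ.≤-respʳ-≃ (fraction n) (ℚ.toℚᵘ-mono-≤ le))
    integers : ℚᵘ.mkℚᵘ (+ 41) 1 ℚᵘ.* ℚᵘ.mkℚᵘ (+ d) 0 ℚᵘ.≤ ℚᵘ.mkℚᵘ (+ n) 0 → 41 * d * 1 ≤ n * 2
    integers (ℚᵘ.*≤* le) = ℤ.drop‿+≤+ (subst₂ ℤ._≤_
      (trans (cong (ℤ._* + 1) (sym (ℤ.pos-* 41 d))) (sym (ℤ.pos-* (41 * d) 1)))
      (sym (ℤ.pos-* n 2)) le)
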